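{- $\mathsf{MaxP} \subseteq \mathsf{MedP} \cap \mathsf{MidP}$.
   Context: Let $\Sigma=\{0,1\}$. NPTM means nondeterministic polynomial-time bounded Turing machine. An NPTM is metric if on every computation path it outputs an integer (in binary, possibly negative) and accepts. $\mathsf{MaxP}$: all functions $max_M$, $M$ a metric NPTM, where $max_M(x)$ is the maximum of the set of all outputs of $M$ on input $x\in\Sigma^*$. $\mathsf{MidP}$: all functions $mid_M$, $M$ a metric NPTM, where if $\{w_1,\dots,w_k\}$ with $w_1<\dots<w_k$ is the set of all outputs of $M$ on input $x\in\Sigma^*$, then $mid_M(x)=w_{\lfloor (k+1)/2\rfloor}$. $\mathsf{MedP}$: all functions $med_M$, $M$ a metric NPTM, where if $w_1\leqslant\dots\leqslant w_k$ is the sequence of all outputs of $M$ on input $x$ with multiplicities (one entry per computation path), then $med_M(x)=w_{\lfloor (k+1)/2\rfloor}$. -}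

module Defs where

open import Data.Bool.Base using (Bool; true; false; if_then_else_)
open import Data.Fin.Base as Fin using (Fin; toℕ)
open import Data.Integer.Base as ℤ using (ℤ; +_; -_; 0ℤ)
open import Data.List.Base as List using (List; []; _∷_; _++_; foldl; length)
open import Data.List.Membership.Propositional using (_∈_)
open import Data.List.Relation.Unary.Unique.Propositional using (Unique)
open import Data.Maybe.Base using (Maybe; nothing; just)
open import Data.Nat.Base as ℕ using (ℕ; zero; suc; ⌊_/2⌋)
open import Data.Product.Base using (Σ-syntax; ∃-syntax; _×_; _,_)
open import Data.Vec.Base as Vec using (Vec; _∷_)
open import Function.Bundles using (_↔_; Inverse)
open import Level as Level using ()
open import Relation.Binary.Core using (_Preserves_⟶_)
open import Relation.Binary.PropositionalEquality using (_≡_)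
open import Relation.Unary using (Pred)

Word : Set
Word = List Bool

-- Binary integers

data OutSymbol : Set where
  minus : OutSymbol
  digit : Bool → OutSymbol

-- Most significant bit first.
binaryValue : List Bool → ℕ
binaryValue = foldl (λ v b → 2 ℕ.* v ℕ.+ (if b then 1 else 0)) 0

-- Standard binary notation: no superfluous leading zeros, no "-0".
data _Denotes_ : List OutSymbol → ℤ → Set where
  zero     : (digit false ∷ []) Denotes 0ℤ
  positive : ∀ bs → List.map digit (true ∷ bs) Denotes (+ binaryValue (true ∷ bs))
  negative : ∀ bs → (minus ∷ List.map digit (true ∷ bs)) Denotes (- (+ binaryValue (true ∷ bs)))

-- Tapes

data Symbol (a : ℕ) : Set where
  blank : Symbol a
  bit   : Bool → Symbol a
  aux   : Fin a → Symbol a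

data Move : Set where
  left stay right : Move

-- A two-way infinite tape.  Both lists are read outwards from the head; all
-- cells beyond them are blank.
record Tape (a : ℕ) : Set where
  constructor tape
  field
    before : List (Symbol a)
    scan   : Symbol a
    after  : List (Symbol a)

open Tape public

blankTape : ∀ {a} → Tape a
blankTape = tape [] blank []

inputTape : ∀ {a} → Word → Tape a
inputTape []       = blankTape
inputTape (b ∷ bs) = tape [] (bit b) (List.map bit bs)

move : ∀ {a} → Move → Tape a → Tape a
move left  (tape []       s rs)       = tape [] blank (s ∷ rs)
move left  (tape (l ∷ ls) s rs)       = tape ls l (s ∷ rs)
move stay  t                          = t
move right (tape ls       s [])       = tape (s ∷ ls) blank []
move right (tape ls       s (r ∷ rs)) = tape (s ∷ ls) r rs

writeMove : ∀ {a} → Symbol a × Move → Tape a → Tape a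
writeMove (s , m) t = move m (record t { scan = s })

-- Nondeterministic multitape Turing machines

-- One possible transition: the new state, what to write on and how to move each
-- tape, and optionally a symbol to append to the write-only output tape.
record Action (State : Set) (tapes a : ℕ) : Set where
  constructor action
  field
    next   : State
    writes : Vec (Symbol a × Move) tapes
    emit   : Maybe OutSymbol

open Action public

-- The tapes are an input tape, which may also be written on, and
-- workTapes further ones.  A machine halts exactly when no transition is
-- available.  The transitions form a set, whence distinct: repetitions in the
-- list would create spurious computation paths.
record Machine : Set₁ where
  field
    State     : Set
    size      : ℕ
    finite    : State ↔ Fin size
    workTapes : ℕ
    auxCount  : ℕ
    start     : State
    accepting : State → Bool
    δ         : State → Vec (Symbol auxCount) (suc workTapes) →
                List (Action State (suc workTapes) auxCount)
    distinct  : ∀ q ss → Unique (δ q ss)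

module Computation (M : Machine) where
  open Machine M

  Act : Set
  Act = Action State (suc workTapes) auxCount

  record Config : Set where
    constructor config
    field
      state  : State
      tapes  : Vec (Tape auxCount) (suc workTapes)
      output : List OutSymbol

  open Config public

  initial : Word → Config
  initial x = config start (inputTape x ∷ Vec.replicate workTapes blankTape) []

  enabled : Config → List Act
  enabled c = δ (state c) (Vec.map scan (tapes c))

  emitted : Maybe OutSymbol → List OutSymbol
  emitted nothing  = []
  emitted (just s) = s ∷ []

  apply : Act → Config → Config
  apply α c = config (next α)
                     (Vec.zipWith writeMove (writes α) (tapes c))
                     (output c ++ emitted (emit α))

  -- Partial computations, by number of steps.
  data Reaches (c : Config) : ℕ → Config → Set where
    none : Reaches c 0 c
    step : ∀ {t c′} (α : Act) → α ∈ enabled c →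
           Reaches (apply α c) t c′ → Reaches c (suc t) c′

  -- Complete (halting) computation paths.
  data PathFrom (c : Config) : Set where
    halt : enabled c ≡ [] → PathFrom c
    step : (α : Act) → α ∈ enabled c → PathFrom (apply α c) → PathFrom c

  final : ∀ {c} → PathFrom c → Config
  final {c} (halt _)     = c
  final     (step _ _ p) = final p

  Path : Word → Set
  Path x = PathFrom (initial x)

  Accepts : ∀ {x} → Path x → Set
  Accepts p = accepting (state (final p)) ≡ true

  Outputs : ∀ {x} → Path x → ℤ → Set
  Outputs p z = output (final p) Denotes z

  -- z belongs to the set of all outputs on input x.
  Output : Word → ℤ → Set
  Output x z = ∃[ p ] Outputs {x} p z

  -- The bound applies to partial computations, so none is infinite.
  PolynomialTime : Set
  PolynomialTime = ∃[ c ] ∃[ d ] (∀ x {t} {κ} → Reaches (initial x) t κ →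
                                  t ℕ.≤ c ℕ.* length x ℕ.^ d ℕ.+ c)

  Metric : Set
  Metric = ∀ x (p : Path x) → Accepts p × (∃[ z ] Outputs p z)

record NPTM : Set₁ where
  field
    machine        : Machine
    polynomialTime : Computation.PolynomialTime machine

  open Computation machine public

module _ (M : NPTM) (x : Word) where
  open NPTM M

  IsMax : ℤ → Set
  IsMax z = Output x z × (∀ {z′} → Output x z′ → z′ ℤ.≤ z)

  -- w lists the k elements of the set of outputs in increasing order.
  record OutputSet (k : ℕ) (w : Fin k → ℤ) : Set where
    field
      increasing : w Preserves Fin._<_ ⟶ ℤ._<_
      sound      : ∀ i → Output x (w i)
      complete   : ∀ {z} → Output x z → ∃[ i ] w i ≡ z

  -- w lists the outputs in nondecreasing order, one entry for each of the k
  -- computation paths.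
  record OutputSequence (k : ℕ) (w : Fin k → ℤ) : Set where
    field
      nondecreasing : w Preserves Fin._≤_ ⟶ ℤ._≤_
      paths         : Fin k ↔ Path x
      correct       : ∀ i → Outputs (Inverse.to paths i) (w i)

-- z is the entry with 1-based index ⌊(k+1)/2⌋; elements of Fin k are 0-based.
Middle : ∀ {k} → (Fin k → ℤ) → ℤ → Set
Middle {k} w z = ∃[ i ] (suc (toℕ i) ≡ ⌊ suc k /2⌋) × (w i ≡ z)

IsMid : NPTM → Word → ℤ → Set
IsMid M x z = ∃[ k ] Σ[ w ∈ (Fin k → ℤ) ] OutputSet M x k w × Middle w z

IsMed : NPTM → Word → ℤ → Set
IsMed M x z = ∃[ k ] Σ[ w ∈ (Fin k → ℤ) ] OutputSequence M x k w × Middle w z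

-- Classes of functions from words to integers

MaxP MidP MedP : Pred (Word → ℤ) (Level.suc Level.zero)
MaxP f = Σ[ M ∈ NPTM ] NPTM.Metric M × (∀ x → IsMax M x (f x))
MidP f = Σ[ M ∈ NPTM ] NPTM.Metric M × (∀ x → IsMid M x (f x))
MedP f = Σ[ M ∈ NPTM ] NPTM.Metric M × (∀ x → IsMed M x (f x))

module Submission where

-- Let M compute f by maxima and run in time T(n).  The machine N first guesses
-- between two modes.  In the first it simulates M.  In the second it prints 1
-- followed by at least T(n) zeros and then simulates M, printing each digit of
-- M as it is and a minus sign as 0.  Outputs of M have at most T(n) symbols, so
-- every output of the second mode exceeds every output of the first, and as
-- the padding depends only on the input, two paths of M have the same output
-- exactly if their counterparts in the second mode do.  Hence, with or without
-- multiplicities, the outputs of N in increasing order are those of M followed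
-- by equally many larger ones, and the middle one is the maximum of M.
--
-- The zeros are printed by an odometer: each of d tapes carries a track of n + 2
-- cells, laid out in a first pass over the input, on which the head moves back
-- and forth, and the heads together take (n + 2) ^ d - 1 steps to exhaust all
-- positions.

open import Defs
open import Data.Bool.Base using (Bool; true; false; not; if_then_else_)
open import Data.Fin.Base as Fin using (Fin; toℕ)
open import Data.Fin.Patterns using (0F; 1F; 2F)
import Data.Fin.Properties as Fin
open import Data.Integer.Base as ℤ using (ℤ; +_; -_)
import Data.Integer.Properties as ℤ
open import Data.List.Base as List using (List; []; _∷_; _++_; foldl; length; lookup; replicate)
open import Data.List.Membership.Propositional using (_∈_; find; lose)
import Data.List.Membership.Propositional.Properties as ∈
open import Data.List.Membership.Propositional.Properties.WithK using (unique⇒irrelevant)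
import Data.List.Properties as List
open import Data.List.Relation.Binary.Permutation.Propositional using (_↭_; ↭-sym; ↭⇒↭ₛ)
import Data.List.Relation.Binary.Permutation.Propositional.Properties as ↭
import Data.List.Relation.Binary.Permutation.Setoid.Properties as ↭ₛ
open import Data.List.Relation.Unary.All as All using (All; []; _∷_)
import Data.List.Relation.Unary.All.Properties as All
open import Data.List.Relation.Unary.AllPairs as AllPairs using (AllPairs; []; _∷_)
import Data.List.Relation.Unary.AllPairs.Properties as AllPairs
open import Data.List.Relation.Unary.Any using (here; there; index)
import Data.List.Relation.Unary.Any.Properties as Any
import Data.List.Relation.Unary.Sorted.TotalOrder.Properties as Sorted
import Data.List.Relation.Unary.Unique.DecSetoid.Properties as DecUnique
open import Data.List.Relation.Unary.Unique.Propositional using (Unique)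
import Data.List.Relation.Unary.Unique.Propositional.Properties as Unique
import Data.List.Sort as Sort
open import Data.Maybe.Base as Maybe using (Maybe; nothing; just)
open import Data.Nat.Base as ℕ
  using (ℕ; zero; suc; _+_; _*_; _^_; _≤_; _<_; z≤n; s≤s; ⌊_/2⌋)
import Data.Nat.Properties as ℕ
open import Data.Nat.Solver using (module +-*-Solver)
open import Data.Product.Base using (∃-syntax; Σ-syntax; _×_; _,_; proj₁; proj₂)
open import Data.Product.Function.NonDependent.Propositional using (_×-↔_)
open import Data.Sum.Base using (_⊎_; inj₁; inj₂)
open import Data.Sum.Function.Propositional using (_⊎-↔_)
open import Data.Vec.Base as Vec using (Vec; []; _∷_)
import Data.Vec.Properties as Vec
open import Data.Vec.Relation.Binary.Pointwise.Inductive as Pointwise using (Pointwise; []; _∷_)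
open import Function.Base using (_∘_; _on_)
open import Function.Bundles using (_↔_; mk↔ₛ′)
open import Function.Construct.Composition using (_↔-∘_)
open import Function.Construct.Identity using (↔-id)
open import Function.Construct.Symmetry using (↔-sym)
open import Level using (0ℓ)
open import Relation.Binary.Bundles using (DecTotalOrder)
import Relation.Binary.Construct.On as On
open import Relation.Binary.Core using (Rel)
open import Relation.Binary.Definitions using (Symmetric; tri<; tri≈; tri>)
open import Relation.Binary.PropositionalEquality
open import Relation.Binary.PropositionalEquality.WithK using (≡-irrelevant)
open import Relation.Nullary using (¬_; contradiction)
open import Relation.Unary using (_⊆_; _∩_)

-- Binary numerals

bitValue : Bool → ℕ
bitValue b = if b then 1 else 0

-- The start value is left free: it stands for the prefix already read, which lets inductions run
-- over the remaining bits. `binaryValue` is the case 0.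
horner : ℕ → List Bool → ℕ
horner = foldl (λ v b → 2 * v + bitValue b)

bitValue≤1 : ∀ b → bitValue b ≤ 1
bitValue≤1 true  = ℕ.≤-refl
bitValue≤1 false = ℕ.z≤n

shift-weight : ∀ v p → v * (2 * p) ≡ 2 * v * p
shift-weight = solve 2 (λ v p → v :* (con 2 :* p) := con 2 :* v :* p) refl
  where open +-*-Solver

horner-lower : ∀ v bs → v * 2 ^ length bs ≤ horner v bs
horner-lower v []       = ℕ.≤-reflexive (ℕ.*-identityʳ v)
horner-lower v (b ∷ bs) = begin
  v * (2 * 2 ^ length bs)             ≡⟨ shift-weight v (2 ^ length bs) ⟩
  2 * v * 2 ^ length bs               ≤⟨ ℕ.*-monoˡ-≤ (2 ^ length bs) (ℕ.m≤m+n (2 * v) (bitValue b)) ⟩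
  (2 * v + bitValue b) * 2 ^ length bs ≤⟨ horner-lower (2 * v + bitValue b) bs ⟩
  horner (2 * v + bitValue b) bs      ∎
  where open ℕ.≤-Reasoning

horner-upper : ∀ v bs → horner v bs < suc v * 2 ^ length bs
horner-upper v []       = ℕ.≤-reflexive (sym (ℕ.*-identityʳ (suc v)))
horner-upper v (b ∷ bs) = begin-strict
  horner (2 * v + bitValue b) bs           <⟨ horner-upper (2 * v + bitValue b) bs ⟩
  suc (2 * v + bitValue b) * 2 ^ length bs ≤⟨ ℕ.*-monoˡ-≤ (2 ^ length bs) step ⟩
  2 * suc v * 2 ^ length bs                ≡⟨ shift-weight (suc v) (2 ^ length bs) ⟨
  suc v * (2 * 2 ^ length bs)              ∎
  where
  open ℕ.≤-Reasoning
  step : suc (2 * v + bitValue b) ≤ 2 * suc v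
  step = begin
    suc (2 * v + bitValue b) ≤⟨ ℕ.s≤s (ℕ.+-monoʳ-≤ (2 * v) (bitValue≤1 b)) ⟩
    suc (2 * v + 1)          ≡⟨ solve 1 (λ v → con 1 :+ (con 2 :* v :+ con 1) := con 2 :* (con 1 :+ v)) refl v ⟩
    2 * suc v                ∎
    where open +-*-Solver

-- With `l` bits still to be read, the values reachable from `v` fill the interval from `v * 2 ^ l`
-- up to, but excluding, `suc v * 2 ^ l`. For distinct start values these intervals are disjoint.
horner-separates : ∀ {v v′} bs bs′ → length bs ≡ length bs′ → v < v′ → horner v bs < horner v′ bs′
horner-separates {v} {v′} bs bs′ eq v<v′ = begin-strict
  horner v bs            <⟨ horner-upper v bs ⟩
  suc v * 2 ^ length bs  ≤⟨ ℕ.*-monoˡ-≤ (2 ^ length bs) v<v′ ⟩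
  v′ * 2 ^ length bs     ≡⟨ cong (λ l → v′ * 2 ^ l) eq ⟩
  v′ * 2 ^ length bs′    ≤⟨ horner-lower v′ bs′ ⟩
  horner v′ bs′          ∎
  where open ℕ.≤-Reasoning

horner-injective : ∀ {v v′} bs bs′ → length bs ≡ length bs′ → horner v bs ≡ horner v′ bs′ → v ≡ v′
horner-injective {v} {v′} bs bs′ eq h with ℕ.<-cmp v v′
... | tri< v<v′ _ _ = contradiction h (ℕ.<⇒≢ (horner-separates bs bs′ eq v<v′))
... | tri≈ _ v≡v′ _ = v≡v′
... | tri> _ _ v′<v = contradiction (sym h) (ℕ.<⇒≢ (horner-separates bs′ bs (sym eq) v′<v))

bitValue-injective : ∀ b b′ → bitValue b ≡ bitValue b′ → b ≡ b′
bitValue-injective true  true  _ = refl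
bitValue-injective false false _ = refl

horner-bits-injective : ∀ v bs bs′ → length bs ≡ length bs′ → horner v bs ≡ horner v bs′ → bs ≡ bs′
horner-bits-injective v []       []         _  _ = refl
horner-bits-injective v (b ∷ bs) (b′ ∷ bs′) eq h
  with refl ← bitValue-injective b b′
                (ℕ.+-cancelˡ-≡ (2 * v) _ _ (horner-injective bs bs′ (ℕ.suc-injective eq) h))
  = cong (b ∷_) (horner-bits-injective (2 * v + bitValue b) bs bs′ (ℕ.suc-injective eq) h)

binaryValue-lower : ∀ bs → 2 ^ length bs ≤ binaryValue (true ∷ bs)
binaryValue-lower bs = subst (_≤ horner 1 bs) (ℕ.*-identityˡ _) (horner-lower 1 bs)

binaryValue-upper : ∀ bs → binaryValue bs < 2 ^ length bs
binaryValue-upper bs = subst (horner 0 bs <_) (ℕ.*-identityˡ _) (horner-upper 0 bs)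

binaryValue-shorter : ∀ bs cs → length bs < length cs → binaryValue (true ∷ bs) < binaryValue (true ∷ cs)
binaryValue-shorter bs cs l = begin-strict
  binaryValue (true ∷ bs)  <⟨ binaryValue-upper (true ∷ bs) ⟩
  2 ^ suc (length bs)      ≤⟨ ℕ.^-monoʳ-≤ 2 l ⟩
  2 ^ length cs            ≤⟨ binaryValue-lower cs ⟩
  binaryValue (true ∷ cs)  ∎
  where open ℕ.≤-Reasoning

-- The leading 1 puts numerals of different lengths between different powers of 2, so equal values
-- force equal lengths; then the bits can be compared from the top.
binaryValue-injective : ∀ bs cs → binaryValue (true ∷ bs) ≡ binaryValue (true ∷ cs) → bs ≡ cs
binaryValue-injective bs cs eq with ℕ.<-cmp (length bs) (length cs)
... | tri< l _ _ = contradiction eq (ℕ.<⇒≢ (binaryValue-shorter bs cs l))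
... | tri≈ _ l _ = horner-bits-injective 1 bs cs l eq
... | tri> _ _ l = contradiction (sym eq) (ℕ.<⇒≢ (binaryValue-shorter cs bs l))

binaryValue-positive : ∀ bs → 0 < binaryValue (true ∷ bs)
binaryValue-positive bs = ℕ.<-≤-trans (ℕ.m^n>0 2 (length bs)) (binaryValue-lower bs)

asBit : OutSymbol → Bool
asBit minus     = false
asBit (digit b) = b

asBits : List OutSymbol → List Bool
asBits = List.map asBit

asBits-digits : ∀ bs → asBits (List.map digit bs) ≡ bs
asBits-digits bs = trans (sym (List.map-∘ bs)) (List.map-id bs)

-- Meaningful on numerals only; other words get junk values.
value : List OutSymbol → ℤ
value (minus ∷ s) = - (+ binaryValue (asBits s))
value s           = + binaryValue (asBits s)

denoted≡value : ∀ {s z} → s Denotes z → z ≡ value s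
denoted≡value zero          = refl
denoted≡value (positive bs) = cong (λ cs → + binaryValue (true ∷ cs)) (sym (asBits-digits bs))
denoted≡value (negative bs) = cong (λ cs → - (+ binaryValue (true ∷ cs))) (sym (asBits-digits bs))

-- Outputs are compared as integers, whereas the padding acts on words. Uniqueness of standard
-- notation translates the former into the latter.
denotes-injective : ∀ {s s′ z z′} → s Denotes z → s′ Denotes z′ → z ≡ z′ → s ≡ s′
denotes-injective zero zero _ = refl
denotes-injective zero (positive cs) eq =
  contradiction (ℤ.+-injective eq) (ℕ.<⇒≢ (binaryValue-positive cs))
denotes-injective zero (negative cs) eq =
  contradiction (ℤ.+-injective (ℤ.neg-injective eq)) (ℕ.<⇒≢ (binaryValue-positive cs))
denotes-injective (positive bs) zero eq =
  contradiction (sym (ℤ.+-injective eq)) (ℕ.<⇒≢ (binaryValue-positive bs))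
denotes-injective (positive bs) (positive cs) eq =
  cong (λ ds → List.map digit (true ∷ ds)) (binaryValue-injective bs cs (ℤ.+-injective eq))
denotes-injective (positive bs) (negative cs) eq
  with binaryValue (true ∷ cs) in cs≡
-- Only at 0 could the two signs meet, and a leading 1 excludes 0.
... | zero  = contradiction (sym cs≡) (ℕ.<⇒≢ (binaryValue-positive cs))
... | suc _ with () ← eq
denotes-injective (negative bs) zero eq =
  contradiction (sym (ℤ.+-injective (ℤ.neg-injective eq))) (ℕ.<⇒≢ (binaryValue-positive bs))
denotes-injective (negative bs) (positive cs) eq
  with binaryValue (true ∷ bs) in bs≡
... | zero  = contradiction (sym bs≡) (ℕ.<⇒≢ (binaryValue-positive bs))
... | suc _ with () ← eq
denotes-injective (negative bs) (negative cs) eq =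
  cong (λ ds → minus ∷ List.map digit (true ∷ ds))
       (binaryValue-injective bs cs (ℤ.+-injective (ℤ.neg-injective eq)))

-- A minus sign may be replaced by 0 without confusion, since a numeral other
-- than 0 never starts with the digit 0.
asBits-injective : ∀ {s s′ z z′} → s Denotes z → s′ Denotes z′ → asBits s ≡ asBits s′ → s ≡ s′
asBits-injective zero zero _ = refl
asBits-injective (positive bs) (positive cs) eq =
  cong (List.map digit) (trans (sym (asBits-digits (true ∷ bs))) (trans eq (asBits-digits (true ∷ cs))))
asBits-injective (negative bs) (negative cs) eq =
  cong (λ ds → minus ∷ List.map digit ds)
       (trans (sym (asBits-digits (true ∷ bs)))
              (trans (List.∷-injectiveʳ eq) (asBits-digits (true ∷ cs))))

-- The exponent counts all symbols, a minus sign included, since that is the number which the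
-- running time bounds.
value-upper : ∀ s → value s ℤ.< + (2 ^ length s)
value-upper []            = ℤ.+<+ (ℕ.s≤s ℕ.z≤n)
value-upper (minus ∷ s)   = ℤ.≤-<-trans (ℤ.neg-≤-pos {binaryValue (asBits s)} {0}) (ℤ.+<+ (ℕ.m^n>0 2 (length (minus ∷ s))))
value-upper (digit b ∷ s) =
  ℤ.+<+ (subst (λ l → binaryValue (asBits (digit b ∷ s)) < 2 ^ l)
               (List.length-map asBit (digit b ∷ s)) (binaryValue-upper (asBits (digit b ∷ s))))

-- What the second mode prints after its leading 1.
padded : ℕ → List OutSymbol → List Bool
padded q s = replicate q false ++ asBits s

padded-value : ℕ → List OutSymbol → ℤ
padded-value q s = + binaryValue (true ∷ padded q s)

padded-value-lower : ∀ q s → + (2 ^ q) ℤ.≤ padded-value q s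
padded-value-lower q s = ℤ.+≤+ (ℕ.≤-trans (ℕ.^-monoʳ-≤ 2 l) (binaryValue-lower (padded q s)))
  where
  l : q ≤ length (padded q s)
  l = begin
    q                                   ≤⟨ ℕ.m≤m+n q _ ⟩
    q + length (asBits s)               ≡⟨ cong (_+ length (asBits s)) (List.length-replicate q) ⟨
    length (replicate q false) + length (asBits s) ≡⟨ List.length-++ (replicate q false) ⟨
    length (padded q s)                 ∎
    where open ℕ.≤-Reasoning

-- The leading 1 makes the value determine all bits behind it, and the common block of zeros
-- cancels. What remains is the numeral with its sign turned into a bit.
padded-value-injective : ∀ q {s s′ z z′} → s Denotes z → s′ Denotes z′ →
                         padded-value q s ≡ padded-value q s′ → s ≡ s′
padded-value-injective q {s} {s′} d d′ eq =
  asBits-injective d d′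
    (List.++-cancelˡ (replicate q false) (asBits s) (asBits s′)
      (binaryValue-injective (padded q s) (padded q s′) (ℤ.+-injective eq)))

-- Sorted lists

lookup-AllPairs : ∀ {A : Set} {R : Rel A 0ℓ} {xs : List A} → AllPairs R xs →
                  ∀ {i j} → i Fin.< j → R (lookup xs i) (lookup xs j)
lookup-AllPairs (Rx ∷ _)  {Fin.zero}  {Fin.suc j} _           = All.lookup Rx (∈.∈-lookup j)
lookup-AllPairs (_  ∷ Rs) {Fin.suc i} {Fin.suc j} (ℕ.s≤s i<j) = lookup-AllPairs Rs i<j

AllPairs-resp-↭ : ∀ {A : Set} {R : Rel A 0ℓ} → Symmetric R → ∀ {xs ys : List A} →
                  xs ↭ ys → AllPairs R xs → AllPairs R ys
AllPairs-resp-↭ {A} {R} R-sym p =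
  ↭ₛ.AllPairs-resp-↭ (setoid A) R-sym ((λ { refl r → r }) , (λ { refl r → r })) (↭⇒↭ₛ p)

lookup-bijection : ∀ {A : Set} (xs : List A) → Unique xs → (∀ a → a ∈ xs) → Fin (length xs) ↔ A
lookup-bijection xs unique complete =
  mk↔ₛ′ (lookup xs) (λ a → index (complete a)) hits
        (λ i → injective (hits (lookup xs i)))
  where
  hits : ∀ a → lookup xs (index (complete a)) ≡ a
  hits a = sym (Any.lookup-index (complete a))
  injective : ∀ {i j} → lookup xs i ≡ lookup xs j → i ≡ j
  injective {i} {j} eq with Fin.<-cmp i j
  ... | tri< i<j _ _ = contradiction eq (lookup-AllPairs unique i<j)
  ... | tri≈ _ i≡j _ = i≡j
  ... | tri> _ _ j<i = contradiction (sym eq) (lookup-AllPairs unique j<i)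

lastOf : ∀ {A : Set} → A → List A → A
lastOf x []       = x
lastOf _ (y ∷ ys) = lastOf y ys

-- Locates the end of the lower half inside the whole list; the 0-based index is `length xs` because
-- `x` precedes `xs`.
lookup-lastOf : ∀ {A : Set} x (xs ys : List A) →
                ∃[ i ] toℕ i ≡ length xs × lookup (x ∷ xs ++ ys) i ≡ lastOf x xs
lookup-lastOf x []        ys = Fin.zero , refl , refl
lookup-lastOf x (y ∷ xs) ys with i , i≡ , eq ← lookup-lastOf y xs ys = Fin.suc i , cong suc i≡ , eq

lastOf-∈ : ∀ {A : Set} x (xs : List A) → lastOf x xs ∈ x ∷ xs
lastOf-∈ x []       = here refl
lastOf-∈ x (y ∷ ys) = there (lastOf-∈ y ys)

⌊1+n+n/2⌋≡n : ∀ n → ⌊ suc (n + n) /2⌋ ≡ n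
⌊1+n+n/2⌋≡n zero    = refl
⌊1+n+n/2⌋≡n (suc n) = cong suc (trans (cong ⌊_/2⌋ (ℕ.+-suc n n)) (⌊1+n+n/2⌋≡n n))

module _ {A : Set} (key : A → ℤ) where

  Increasing : List A → Set
  Increasing = AllPairs (ℤ._≤_ on key)

  sortOn : (xs : List A) → ∃[ ys ] ys ↭ xs × Increasing ys
  sortOn xs = sort xs , sort-↭ xs , Sorted.Sorted⇒AllPairs totalOrder (sort-↗ xs)
    where
    order = On.decTotalOrder ℤ.≤-decTotalOrder key
    open Sort order
    open DecTotalOrder order using (totalOrder)

  lookup-mono : ∀ {xs} → Increasing xs →
                ∀ {i j} → i Fin.≤ j → key (lookup xs i) ℤ.≤ key (lookup xs j)
  lookup-mono {xs} incr {i} {j} i≤j with ℕ.m≤n⇒m<n∨m≡n i≤j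
  ... | inj₁ i<j = lookup-AllPairs incr i<j
  ... | inj₂ i≡j = ℤ.≤-reflexive (cong (key ∘ lookup xs) (Fin.toℕ-injective i≡j))

  lastOf-largest : ∀ x xs → Increasing (x ∷ xs) → All (λ y → key y ℤ.≤ key (lastOf x xs)) (x ∷ xs)
  lastOf-largest x []        _              = ℤ.≤-refl ∷ []
  lastOf-largest x (y ∷ ys) ((x≤y ∷ _) ∷ incr) with y≤ ∷ ys≤ ← lastOf-largest y ys incr =
    ℤ.≤-trans x≤y y≤ ∷ y≤ ∷ ys≤

  -- Passes from paths to the set of outputs: one element is retained for each key.
  distinctKeys : (xs : List A) →
                 ∃[ ys ] AllPairs (λ a b → key a ≢ key b) ys × (∀ {a} → a ∈ xs → ∃[ b ] b ∈ ys × key b ≡ key a)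
  distinctKeys xs =
    List.deduplicate _≟_ xs , DecUnique.deduplicate-! (On.decSetoid (decSetoid ℤ._≟_) key) xs , represented
    where
    _≟_ = λ a b → key a ℤ.≟ key b
    represented : ∀ {a} → a ∈ xs → ∃[ b ] b ∈ List.deduplicate _≟_ xs × key b ≡ key a
    represented {a} a∈xs
      with b , b∈ , eq ← find (Any.deduplicate⁺ _≟_ {P = λ b → key b ≡ key a} (λ eq eq′ → trans eq eq′)
                                 (lose a∈xs refl))
      = b , b∈ , eq

module _ {A B : Set} (e₀ e₁ : A → B) where

  doubled : List A → List B
  doubled as = List.map e₀ as ++ List.map e₁ as

  doubled-AllPairs : ∀ {R : Rel B 0ℓ} {as} →
                     AllPairs (λ a b → R (e₀ a) (e₀ b)) as → AllPairs (λ a b → R (e₁ a) (e₁ b)) as →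
                     (∀ a b → R (e₀ a) (e₁ b)) → AllPairs R (doubled as)
  doubled-AllPairs {as = as} R₀ R₁ R₀₁ =
    AllPairs.++⁺ (AllPairs.map⁺ R₀) (AllPairs.map⁺ R₁)
      (All.map⁺ (All.universal (λ a → All.map⁺ (All.universal (R₀₁ a) as)) as))

  -- The relation is a parameter so that the lemma serves both counts: equality of paths for the
  -- median, equality of keys for the midpoint.
  doubled-representatives : ∀ {R : Rel B 0ℓ} {as} →
                            (∀ b → (∃[ a ] e₀ a ≡ b) ⊎ (∃[ a ] e₁ a ≡ b)) →
                            (∀ a → ∃[ a′ ] a′ ∈ as × R (e₀ a′) (e₀ a)) → (∀ a → ∃[ a′ ] a′ ∈ as × R (e₁ a′) (e₁ a)) →
                            ∀ b → ∃[ b′ ] b′ ∈ doubled as × R b′ b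
  doubled-representatives {as = as} cover rep₀ rep₁ b with cover b
  ... | inj₁ (a , refl) with a′ , a′∈ , r ← rep₀ a = e₀ a′ , ∈.∈-++⁺ˡ (∈.∈-map⁺ e₀ a′∈) , r
  ... | inj₂ (a , refl) with a′ , a′∈ , r ← rep₁ a = e₁ a′ , ∈.∈-++⁺ʳ (List.map e₀ as) (∈.∈-map⁺ e₁ a′∈) , r

  doubled-complete : ∀ {as} → (∀ b → (∃[ a ] e₀ a ≡ b) ⊎ (∃[ a ] e₁ a ≡ b)) →
                     (∀ a → a ∈ as) → ∀ b → b ∈ doubled as
  doubled-complete cover complete b
    with b′ , b′∈ , refl ← doubled-representatives {R = _≡_} cover (λ a → a , complete a , refl)
                                                                (λ a → a , complete a , refl) b
    = b′∈

-- Embedding one copy of a list below another puts the largest element of the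
-- lower copy in the middle.
module _ {A B : Set} (key : B → ℤ) (e₀ e₁ : A → B)
         (e₀≤e₁ : ∀ a b → key (e₀ a) ℤ.≤ key (e₁ b)) where

  sortDoubled : ∀ {as a} → a ∈ as → (∀ b → key (e₀ b) ℤ.≤ key (e₀ a)) →
                ∃[ bs ] bs ↭ doubled e₀ e₁ as × Increasing key bs × Middle (key ∘ lookup bs) (key (e₀ a))
  sortDoubled {as} {a} a∈as a-max with sortOn (key ∘ e₀) as
  ... | [] , p , _ = contradiction (↭.∈-resp-↭ (↭-sym p) a∈as) λ ()
  ... | x ∷ xs , p , incr with ys , q , incr′ ← sortOn (key ∘ e₁) as =
    -- The halves are sorted separately; as every lower key is at most every upper key, the
    -- concatenation is sorted.
    bs , ↭.++⁺ (↭.map⁺ e₀ p) (↭.map⁺ e₁ q) ,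
    AllPairs.++⁺ (AllPairs.map⁺ incr) (AllPairs.map⁺ incr′) low≤high , middle
    where
    bs = List.map e₀ (x ∷ xs) ++ List.map e₁ ys

    low≤high : All (λ b → All (λ c → key b ℤ.≤ key c) (List.map e₁ ys)) (List.map e₀ (x ∷ xs))
    low≤high = All.map⁺ (All.universal (λ b → All.map⁺ (All.universal (λ c → e₀≤e₁ b c) ys)) (x ∷ xs))

    length-bs : length bs ≡ suc (length xs) + suc (length xs)
    length-bs = begin
      length bs
        ≡⟨ List.length-++ (List.map e₀ (x ∷ xs)) ⟩
      length (List.map e₀ (x ∷ xs)) + length (List.map e₁ ys)
        ≡⟨ cong₂ _+_ (List.length-map e₀ (x ∷ xs)) (List.length-map e₁ ys) ⟩
      suc (length xs) + length ys
        ≡⟨ cong (λ l → suc (length xs) + l) (trans (↭.↭-length q) (sym (↭.↭-length p))) ⟩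
      suc (length xs) + suc (length xs) ∎
      where open ≡-Reasoning

    lastOf-map : ∀ y zs → lastOf (e₀ y) (List.map e₀ zs) ≡ e₀ (lastOf y zs)
    lastOf-map y []       = refl
    lastOf-map _ (z ∷ zs) = lastOf-map z zs

    middle : Middle (key ∘ lookup bs) (key (e₀ a))
    middle with i , i≡ , eq ← lookup-lastOf (e₀ x) (List.map e₀ xs) (List.map e₁ ys) =
      -- Because of ties, sorting need not put `a` itself last in the lower half; only the keys
      -- agree, by two inequalities.
      i , position , ℤ.≤-antisym ≤max max≤
      where
      -- With `m` entries in each half, the last lower entry has 1-based index `m`, which is half of
      -- `2m + 1` rounded down.
      position : suc (toℕ i) ≡ ⌊ suc (length bs) /2⌋
      position = begin
        suc (toℕ i)                                   ≡⟨ cong suc (trans i≡ (List.length-map e₀ xs)) ⟩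
        suc (length xs)                               ≡⟨ ⌊1+n+n/2⌋≡n (suc (length xs)) ⟨
        ⌊ suc (suc (length xs) + suc (length xs)) /2⌋ ≡⟨ cong (λ n → ⌊ suc n /2⌋) length-bs ⟨
        ⌊ suc (length bs) /2⌋                         ∎
        where open ≡-Reasoning

      lookup≡ : lookup bs i ≡ e₀ (lastOf x xs)
      lookup≡ = trans eq (lastOf-map x xs)

      ≤max : key (lookup bs i) ℤ.≤ key (e₀ a)
      ≤max = subst (λ b → key b ℤ.≤ key (e₀ a)) (sym lookup≡) (a-max (lastOf x xs))

      max≤ : key (e₀ a) ℤ.≤ key (lookup bs i)
      max≤ = subst (λ b → key (e₀ a) ℤ.≤ key b) (sym lookup≡)
               (All.lookup (lastOf-largest (key ∘ e₀) x xs incr) (↭.∈-resp-↭ (↭-sym p) a∈as))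

-- Computation paths

module Paths (M : Machine) where
  open Machine M using (distinct)
  open Computation M

  trace : ∀ {c} → PathFrom c → List Act
  trace (halt _)     = []
  trace (step α _ p) = α ∷ trace p

  -- Besides actions, a path holds proofs of halting and of membership. Both are unique, the latter
  -- because no transition is listed twice, so the actions determine the path.
  trace-injective : ∀ {c} (p q : PathFrom c) → trace p ≡ trace q → p ≡ q
  trace-injective (halt h)     (halt h′)      _ = cong halt (≡-irrelevant h h′)
  trace-injective (step α m p) (step β m′ q) eq
    with refl ← List.∷-injectiveˡ eq
    with refl ← unique⇒irrelevant (distinct _ _) m m′
    = cong (step α m) (trace-injective p q (List.∷-injectiveʳ eq))

  run : ∀ {c} (p : PathFrom c) → Reaches c (length (trace p)) (final p)
  run (halt _)     = none
  run (step α m p) = step α m (run p)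

  emitted-length : ∀ e → length (emitted e) ≤ 1
  emitted-length nothing  = z≤n
  emitted-length (just _) = s≤s z≤n

  output-length : ∀ {c t κ} → Reaches c t κ → length (output κ) ≤ length (output c) + t
  output-length none = ℕ.m≤m+n _ 0
  output-length {c} {suc t} {κ} (step α _ r) = begin
    length (output κ)                               ≤⟨ output-length r ⟩
    length (output c ++ emitted (emit α)) + t       ≡⟨ cong (_+ t) (List.length-++ (output c)) ⟩
    length (output c) + length (emitted (emit α)) + t
      ≤⟨ ℕ.+-monoˡ-≤ t (ℕ.+-monoʳ-≤ (length (output c)) (emitted-length (emit α))) ⟩
    length (output c) + 1 + t                       ≡⟨ ℕ.+-assoc (length (output c)) 1 t ⟩
    length (output c) + suc t                       ∎
    where open ℕ.≤-Reasoning

  key : ∀ {c} → PathFrom c → ℤ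
  key p = value (output (final p))

  module _ {c : Config} (continuations : ∀ α → α ∈ enabled c → Σ[ ps ∈ List (PathFrom (apply α c)) ] Unique ps × (∀ p → p ∈ ps)) where

    -- The recursion carries the inclusion of `as` in the enabled actions, as continuations are
    -- given for enabled actions only.
    stepPaths : (as : List Act) → (∀ {α} → α ∈ as → α ∈ enabled c) → List (PathFrom c)
    stepPaths []       _  = []
    stepPaths (α ∷ as) as⊆ =
      List.map (step α (as⊆ (here refl))) (proj₁ (continuations α (as⊆ (here refl)))) ++ stepPaths as (as⊆ ∘ there)

    -- The first action is what tells apart the blocks of paths contributed by different actions.
    stepPaths-sound : ∀ as (as⊆ : ∀ {α} → α ∈ as → α ∈ enabled c) {p} → p ∈ stepPaths as as⊆ →
                      ∃[ α ] α ∈ as × (∃[ αs ] trace p ≡ α ∷ αs)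
    stepPaths-sound (α ∷ as) as⊆ p∈
      with ∈.∈-++⁻ (List.map (step α (as⊆ (here refl))) (proj₁ (continuations α (as⊆ (here refl))))) p∈
    ... | inj₁ p∈ with q , _ , refl ← ∈.∈-map⁻ _ p∈ = α , here refl , trace q , refl
    ... | inj₂ p∈ with β , β∈ , αs , eq ← stepPaths-sound as (as⊆ ∘ there) p∈ = β , there β∈ , αs , eq

    stepPaths-unique : ∀ as (as⊆ : ∀ {α} → α ∈ as → α ∈ enabled c) → Unique as → Unique (stepPaths as as⊆)
    stepPaths-unique []       _   _              = []
    stepPaths-unique (α ∷ as) as⊆ (α∉as ∷ unique) =
      Unique.++⁺ (Unique.map⁺ (λ { refl → refl }) (proj₁ (proj₂ (continuations α (as⊆ (here refl))))))
                 (stepPaths-unique as (as⊆ ∘ there) unique)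
                 disjoint
      where
      disjoint : ∀ {p} → ¬ (p ∈ List.map (step α (as⊆ (here refl))) (proj₁ (continuations α (as⊆ (here refl)))) ×
                            p ∈ stepPaths as (as⊆ ∘ there))
      disjoint (p∈ , p∈′)
        with q , _ , refl ← ∈.∈-map⁻ _ p∈
        with β , β∈ , _ , eq ← stepPaths-sound as (as⊆ ∘ there) p∈′
        = All.lookup α∉as β∈ (List.∷-injectiveˡ eq)

    stepPaths-complete : ∀ as (as⊆ : ∀ {α} → α ∈ as → α ∈ enabled c) {α} → α ∈ as →
                         ∀ α∈ p → step α α∈ p ∈ stepPaths as as⊆
    stepPaths-complete (α ∷ as) as⊆ (here refl) α∈ p
      with refl ← unique⇒irrelevant (distinct _ _) α∈ (as⊆ (here refl))
      = ∈.∈-++⁺ˡ (∈.∈-map⁺ _ (proj₂ (proj₂ (continuations α (as⊆ (here refl)))) p))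
    stepPaths-complete (β ∷ as) as⊆ (there α∈as) α∈ p =
      ∈.∈-++⁺ʳ (List.map _ (proj₁ (continuations β (as⊆ (here refl))))) (stepPaths-complete as (as⊆ ∘ there) α∈as α∈ p)

  -- The time bound is the fuel: each step lowers it by one, and at 0 an enabled action would
  -- already be a computation that is too long.
  allPaths : ∀ n c → (∀ {t κ} → Reaches c t κ → t ≤ n) →
             Σ[ ps ∈ List (PathFrom c) ] Unique ps × (∀ p → p ∈ ps)
  allPaths n c bound with enabled c in eq
  allPaths n c bound | [] = halt eq ∷ [] , [] ∷ [] , complete
    where
    complete : ∀ p → p ∈ halt eq ∷ []
    complete (halt h)     = here (cong halt (≡-irrelevant h eq))
    complete (step α m _) = contradiction (subst (α ∈_) eq m) λ ()
  allPaths zero c bound | α ∷ _ =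
    contradiction (bound (step α (subst (α ∈_) (sym eq) (here refl)) none)) λ ()
  allPaths (suc n) c bound | _ ∷ _ =
    stepPaths continuations (enabled c) (λ m → m) ,
    stepPaths-unique continuations (enabled c) (λ m → m) (distinct _ _) ,
    complete
    where
    continuations : ∀ α → α ∈ enabled c → Σ[ ps ∈ List (PathFrom (apply α c)) ] Unique ps × (∀ p → p ∈ ps)
    continuations α m = allPaths n (apply α c) (λ r → ℕ.s≤s⁻¹ (bound (step α m r)))
    complete : ∀ p → p ∈ stepPaths continuations (enabled c) (λ m → m)
    complete (halt h)     = contradiction (trans (sym eq) h) λ ()
    complete (step α m p) = stepPaths-complete continuations (enabled c) (λ m → m) m m p

  -- Deterministic stretches of a computation

  data Forced : ℕ → Config → Config → Set where
    done : ∀ {c c′} → c ≡ c′ → Forced 0 c c′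
    step : ∀ {n c c′ c″} α → enabled c ≡ α ∷ [] → apply α c ≡ c′ → Forced n c′ c″ → Forced (suc n) c c″

  forced-++ : ∀ {m n c c′ c″} → Forced m c c′ → Forced n c′ c″ → Forced (m + n) c c″
  forced-++ (done refl)      g = g
  forced-++ (step α eq a≡ f) g = step α eq a≡ (forced-++ f g)

  forced-target : ∀ {n c c′ c″} → c′ ≡ c″ → Forced n c c′ → Forced n c c″
  forced-target refl f = f

  forcedTrace : ∀ {n c c′} → Forced n c c′ → List Act
  forcedTrace (done _)       = []
  forcedTrace (step α _ _ f) = α ∷ forcedTrace f

  extend : ∀ {n c c′} → Forced n c c′ → PathFrom c′ → PathFrom c
  extend (done refl)        p = p
  extend (step α eq refl f) p = step α (subst (α ∈_) (sym eq) (here refl)) (extend f p)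

  extend-final : ∀ {n c c′} (f : Forced n c c′) (p : PathFrom c′) → final (extend f p) ≡ final p
  extend-final (done refl)       p = refl
  extend-final (step _ _ refl f) p = extend-final f p

  extend-trace : ∀ {n c c′} (f : Forced n c c′) (p : PathFrom c′) →
                 trace (extend f p) ≡ forcedTrace f ++ trace p
  extend-trace (done refl)       p = refl
  extend-trace (step α _ refl f) p = cong (α ∷_) (extend-trace f p)

  -- The actions of the forced run are a common prefix of both traces and cancel.
  extend-injective : ∀ {n c c′} (f : Forced n c c′) (p q : PathFrom c′) → extend f p ≡ extend f q → p ≡ q
  extend-injective f p q eq =
    trace-injective p q (List.++-cancelˡ (forcedTrace f) (trace p) (trace q)
      (trans (sym (extend-trace f p)) (trans (cong trace eq) (extend-trace f q))))

  extend-surjective : ∀ {n c c′} (f : Forced n c c′) (p : PathFrom c) → ∃[ q ] extend f q ≡ p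
  extend-surjective (done refl) p = p , refl
  extend-surjective (step α eq refl f) (halt h) = contradiction (trans (sym eq) h) λ ()
  extend-surjective (step α eq refl f) (step β m p)
    with here refl ← subst (β ∈_) eq m
    with q , refl ← extend-surjective f p
    -- The two paths have the same actions and differ at most in a membership proof.
    = q , trace-injective (extend (step α eq refl f) q) (step α m (extend f q)) refl

  -- A computation either ends within the forced run or passes through its target.
  forced-bound : ∀ {n c c′ m} → Forced n c c′ → (∀ {t κ} → Reaches c′ t κ → t ≤ m) →
                 ∀ {t κ} → Reaches c t κ → t ≤ n + m
  forced-bound (done refl)          bound r    = bound r
  forced-bound (step α eq refl f) bound none = z≤n
  forced-bound (step α eq refl f) bound (step β m r)
    with here refl ← subst (β ∈_) eq m
    = s≤s (forced-bound f bound r)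

-- Output lists of metric machines, and two copies of the paths

module _ (N : NPTM) (metric : NPTM.Metric N) (x : Word) where
  open NPTM N using (machine; polynomialTime; initial; Path; Outputs; Output)
  open Paths machine

  listPaths : Σ[ ps ∈ List (Path x) ] Unique ps × (∀ p → p ∈ ps)
  listPaths with _ , _ , bound ← polynomialTime = allPaths _ (initial x) (bound x)

  outputs-key : (p : Path x) → Outputs {x} p (key p)
  outputs-key p with _ , z , d ← metric x p = subst (Outputs {x} p) (denoted≡value d) d

  outputSequence : (ps : List (Path x)) → Unique ps → (∀ p → p ∈ ps) → Increasing key ps →
                   OutputSequence N x (length ps) (key ∘ lookup ps)
  outputSequence ps unique complete incr = record
    { nondecreasing = lookup-mono key incr
    ; paths         = lookup-bijection ps unique complete
    ; correct       = λ i → outputs-key (lookup ps i)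
    }

  outputSet : (ps : List (Path x)) → AllPairs (λ p q → key p ≢ key q) ps →
              (∀ p → ∃[ q ] q ∈ ps × key q ≡ key p) → Increasing key ps →
              OutputSet N x (length ps) (key ∘ lookup ps)
  outputSet ps distinctKeys complete incr = record
    { increasing = lookup-AllPairs (AllPairs.zipWith (λ (p≢q , p≤q) → ℤ.≤∧≢⇒< p≤q p≢q) (distinctKeys , incr))
    ; sound      = λ i → lookup ps i , outputs-key (lookup ps i)
    ; complete   = listed
    }
    where
    listed : ∀ {z} → Output x z → ∃[ i ] key (lookup ps i) ≡ z
    listed (p , d) with q , q∈ , eq ← complete p =
      index q∈ , trans (cong key (sym (Any.lookup-index q∈))) (trans eq (sym (denoted≡value d)))

-- The interface between the machine construction and the counting. The high copy need not preserve
-- keys, only which of them coincide; this gives both copies equally many distinct outputs.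
record TwoCopies (M N : NPTM) (x : Word) : Set where
  private
    module M = NPTM M
    module N = NPTM N
    keyM : M.Path x → ℤ
    keyM = Paths.key M.machine
    keyN : N.Path x → ℤ
    keyN = Paths.key N.machine
  field
    low high           : M.Path x → N.Path x
    low-injective      : ∀ p q → low p ≡ low q → p ≡ q
    high-injective     : ∀ p q → high p ≡ high q → p ≡ q
    cover              : ∀ r → (∃[ p ] low p ≡ r) ⊎ (∃[ p ] high p ≡ r)
    low-key            : ∀ p → keyN (low p) ≡ keyM p
    high-key-cong      : ∀ p q → keyM p ≡ keyM q → keyN (high p) ≡ keyN (high q)
    high-key-injective : ∀ p q → keyN (high p) ≡ keyN (high q) → keyM p ≡ keyM q
    low<high           : ∀ p q → keyN (low p) ℤ.< keyN (high q)

module _ (M N : NPTM) (metric-M : NPTM.Metric M) (metric-N : NPTM.Metric N) (x : Word)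
         (copies : TwoCopies M N x) {z : ℤ} (max : IsMax M x z) where
  open TwoCopies copies
  private
    module M = NPTM M
    module N = NPTM N
    module PM = Paths M.machine
    module PN = Paths N.machine

    best : M.Path x
    best = proj₁ (proj₁ max)

    best-key : PN.key (low best) ≡ z
    best-key = trans (low-key best) (sym (denoted≡value (proj₂ (proj₁ max))))

    best-largest : ∀ p → PN.key (low p) ℤ.≤ PN.key (low best)
    best-largest p = begin
      PN.key (low p)    ≡⟨ low-key p ⟩
      PM.key p          ≤⟨ proj₂ max (p , outputs-key M metric-M x p) ⟩
      z                 ≡⟨ best-key ⟨
      PN.key (low best) ∎
      where open ℤ.≤-Reasoning

    low-key-injective : ∀ p q → PN.key (low p) ≡ PN.key (low q) → PM.key p ≡ PM.key q
    low-key-injective p q eq = trans (sym (low-key p)) (trans eq (low-key q))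

    low-key-cong : ∀ p q → PM.key p ≡ PM.key q → PN.key (low p) ≡ PN.key (low q)
    low-key-cong p q eq = trans (low-key p) (trans eq (sym (low-key q)))

    -- Only the key of `p` has to be that of `best`, since `best` itself may have been dropped when
    -- duplicates were removed.
    sortCopies : ∀ {ps p} → p ∈ ps → PM.key p ≡ PM.key best →
                 ∃[ rs ] rs ↭ doubled low high ps × Increasing PN.key rs × Middle (PN.key ∘ lookup rs) z
    sortCopies {ps} {p} p∈ps p≡ =
      let rs , rs↭ , incr , middle = sortDoubled PN.key low high (λ p q → ℤ.<⇒≤ (low<high p q)) p∈ps
                                       (λ q → subst (PN.key (low q) ℤ.≤_) (sym keys≡) (best-largest q))
      in rs , rs↭ , incr , subst (Middle (PN.key ∘ lookup rs)) (trans keys≡ best-key) middle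
      where
      keys≡ : PN.key (low p) ≡ PN.key (low best)
      keys≡ = low-key-cong p best p≡

  median : IsMed N x z
  median with ps , unique , complete ← listPaths M metric-M x
         with rs , rs↭ , incr , middle ← sortCopies (complete best) refl =
    length rs , PN.key ∘ lookup rs ,
    outputSequence N metric-N x rs
      (AllPairs-resp-↭ ≢-sym (↭-sym rs↭)
        (doubled-AllPairs low high
          (AllPairs.map (λ {p} {q} p≢q eq → p≢q (low-injective p q eq)) unique)
          (AllPairs.map (λ {p} {q} p≢q eq → p≢q (high-injective p q eq)) unique)
          (λ p q eq → ℤ.<⇒≢ (low<high p q) (cong PN.key eq))))
      (λ r → ↭.∈-resp-↭ (↭-sym rs↭) (doubled-complete low high cover complete r))
      incr ,
    middle

  -- The argument for the median, run on one path of `M` for each output. Within either copy keys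
  -- coincide exactly when they do in `M`, so this list yields each output of `N` exactly once.
  midpoint : IsMid N x z
  midpoint with ps , _ , complete ← listPaths M metric-M x
           with qs , distinct , represented ← distinctKeys PM.key ps
           with b , b∈ , b≡ ← represented (complete best)
           with rs , rs↭ , incr , middle ← sortCopies b∈ b≡ =
    length rs , PN.key ∘ lookup rs ,
    outputSet N metric-N x rs
      (AllPairs-resp-↭ ≢-sym (↭-sym rs↭)
        (doubled-AllPairs low high
          (AllPairs.map (λ {p} {q} p≢q eq → p≢q (low-key-injective p q eq)) distinct)
          (AllPairs.map (λ {p} {q} p≢q eq → p≢q (high-key-injective p q eq)) distinct)
          (λ p q → ℤ.<⇒≢ (low<high p q))))
      (λ r → let r′ , r′∈ , eq = doubled-representatives low high {R = λ r r′ → PN.key r ≡ PN.key r′} cover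
                                   (λ p → let q , q∈ , eq = represented (complete p) in q , q∈ , low-key-cong q p eq)
                                   (λ p → let q , q∈ , eq = represented (complete p) in q , q∈ , high-key-cong q p eq) r
             in r′ , ↭.∈-resp-↭ (↭-sym rs↭) r′∈ , eq)
      incr ,
    middle

-- Tapes up to trailing blanks, which the first pass over the input adds

data _≲_ {a : ℕ} : List (Symbol a) → List (Symbol a) → Set where
  []  : [] ≲ []
  pad : ∀ {ss} → [] ≲ ss → [] ≲ (blank ∷ ss)
  _∷_ : ∀ s {ss ss′} → ss ≲ ss′ → (s ∷ ss) ≲ (s ∷ ss′)

data _≼_ {a : ℕ} : Tape a → Tape a → Set where
  tape : ∀ {ls ls′ s rs rs′} → ls ≲ ls′ → rs ≲ rs′ → tape ls s rs ≼ tape ls′ s rs′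

≲-refl : ∀ {a} {ss : List (Symbol a)} → ss ≲ ss
≲-refl {ss = []}     = []
≲-refl {ss = s ∷ ss} = s ∷ ≲-refl

≲-blank : ∀ {a} {ss : List (Symbol a)} → ss ≲ (ss ++ blank ∷ [])
≲-blank {ss = []}     = pad []
≲-blank {ss = s ∷ ss} = s ∷ ≲-blank

-- Stepping beyond the stored cells produces a blank, which is just what the padding holds.
≼-move : ∀ {a} m {t t′ : Tape a} → t ≼ t′ → move m t ≼ move m t′
≼-move left  (tape []       rs) = tape [] (_ ∷ rs)
≼-move left  (tape (pad ls) rs) = tape ls (_ ∷ rs)
≼-move left  (tape (_ ∷ ls) rs) = tape ls (_ ∷ rs)
≼-move stay  t≼t′               = t≼t′
≼-move right (tape ls []      ) = tape (_ ∷ ls) []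
≼-move right (tape ls (pad rs)) = tape (_ ∷ ls) rs
≼-move right (tape ls (_ ∷ rs)) = tape (_ ∷ ls) rs

≼-writeMove : ∀ {a} w {t t′ : Tape a} → t ≼ t′ → writeMove w t ≼ writeMove w t′
≼-writeMove (_ , m) (tape ls rs) = ≼-move m (tape ls rs)

≼-writeMoves : ∀ {a n} ws {ts ts′ : Vec (Tape a) n} → Pointwise _≼_ ts ts′ →
               Pointwise _≼_ (Vec.zipWith writeMove ws ts) (Vec.zipWith writeMove ws ts′)
≼-writeMoves []       []             = []
≼-writeMoves (w ∷ ws) (t≼t′ ∷ ts≼ts′) = ≼-writeMove w t≼t′ ∷ ≼-writeMoves ws ts≼ts′

≼-scans : ∀ {a n} {ts ts′ : Vec (Tape a) n} → Pointwise _≼_ ts ts′ → Vec.map scan ts ≡ Vec.map scan ts′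
≼-scans []                 = refl
≼-scans (tape _ _ ∷ ts≼ts′) = cong (_ ∷_) (≼-scans ts≼ts′)

≼-refl : ∀ {a} {t : Tape a} → t ≼ t
≼-refl = tape ≲-refl ≲-refl

-- Every action writes on every tape, so an idle tape has the scanned symbol rewritten.
keep : ∀ {a n} → Vec (Symbol a) n → Vec (Symbol a × Move) n
keep = Vec.map (_, stay)

keep-writes : ∀ {a n} (ts : Vec (Tape a) n) → Vec.zipWith writeMove (keep (Vec.map scan ts)) ts ≡ ts
keep-writes []       = refl
keep-writes (t ∷ ts) = cong (t ∷_) (keep-writes ts)

-- A zigzag odometer

-- The content of a cell in terms of its distances to the left and right ends of the track.
cell : ∀ {a} → ℕ → ℕ → Symbol a
cell zero    _       = bit false
cell (suc _) zero    = bit true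
cell (suc _) (suc _) = blank

side : ∀ {a} → Bool → ℕ → List (Symbol a)
side b zero    = []
side b (suc k) = replicate k blank ++ bit b ∷ []

-- A track is delimited by the symbols bit false (left) and bit true (right);
-- the head has p cells of it to the left and q to the right.
track : ∀ {a} → ℕ → ℕ → Tape a
track p q = tape (side false p) (cell p q) (side true q)

track-right : ∀ {a} p q → writeMove {a} (cell p (suc q) , right) (track p (suc q)) ≡ track (suc p) q
track-right zero    zero    = refl
track-right zero    (suc q) = refl
track-right (suc p) zero    = refl
track-right (suc p) (suc q) = refl

track-left : ∀ {a} p q → writeMove {a} (cell (suc p) q , left) (track (suc p) q) ≡ track p (suc q)
track-left zero    zero    = refl
track-left zero    (suc q) = refl
track-left (suc p) zero    = refl
track-left (suc p) (suc q) = refl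

exhausted : ∀ {a} → Bool → Symbol a → Bool
exhausted true  (bit true)  = true
exhausted false (bit false) = true
exhausted _     _           = false

heading : Bool → Move
heading true  = right
heading false = left

-- The first head that has not reached the end of its track moves on, and the
-- heads before it turn around.
tick : ∀ {a k} → Vec Bool k → Vec (Symbol a) k → Maybe (Vec Bool k × Vec (Symbol a × Move) k)
tick []       []       = nothing
tick (d ∷ ds) (s ∷ ss) with exhausted d s
... | true  = Maybe.map (λ (ds′ , ws) → not d ∷ ds′ , (s , stay) ∷ ws) (tick ds ss)
... | false = just (d ∷ ds , (s , heading d) ∷ keep ss)

tick-moves : ∀ {a k} d (ds : Vec Bool k) (s : Symbol a) ss → exhausted d s ≡ false →
             tick (d ∷ ds) (s ∷ ss) ≡ just (d ∷ ds , (s , heading d) ∷ keep ss)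
tick-moves d ds s ss eq rewrite eq = refl

tick-turns : ∀ {a k} d (ds : Vec Bool k) (s : Symbol a) ss → exhausted d s ≡ true →
             tick (d ∷ ds) (s ∷ ss) ≡
             Maybe.map (λ (ds′ , ws) → not d ∷ ds′ , (s , stay) ∷ ws) (tick ds ss)
tick-turns d ds s ss eq rewrite eq = refl

-- One wheel of the odometer. A track of `n + 2` cells has distinct ends even for empty input, so
-- the two marks never compete for a cell.
record Digit (n : ℕ) : Set where
  constructor digit
  field
    rightward    : Bool
    below above  : ℕ
    total        : below + above ≡ suc n

open Digit

remaining : ∀ {n} → Digit n → ℕ
remaining (digit true  _ q _) = q
remaining (digit false p _ _) = p

digitTape : ∀ {a n} → Digit n → Tape a
digitTape d = track (below d) (above d)

turn : ∀ {n} → Digit n → Digit n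
turn (digit d p q eq) = digit (not d) p q eq

data DigitStep (a : ℕ) {n} (d : Digit n) : Set where
  stuck : exhausted {a} (rightward d) (scan (digitTape d)) ≡ true → remaining d ≡ 0 →
          remaining (turn d) ≡ suc n → DigitStep a d
  moves : ∀ (d′ : Digit n) → exhausted {a} (rightward d) (scan (digitTape d)) ≡ false → rightward d′ ≡ rightward d →
          writeMove {a} (scan (digitTape d) , heading (rightward d)) (digitTape d) ≡ digitTape d′ →
          remaining d ≡ suc (remaining d′) → DigitStep a d

digitStep : ∀ a {n} (d : Digit n) → DigitStep a d
digitStep a (digit true zero zero ())
digitStep a (digit true (suc p) zero    eq) = stuck refl refl (trans (sym (ℕ.+-identityʳ (suc p))) eq)
digitStep a (digit true zero    (suc q) eq) =
  moves (digit true 1 q eq) refl refl (track-right 0 q) refl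
digitStep a (digit true (suc p) (suc q) eq) =
  moves (digit true (suc (suc p)) q (trans (sym (ℕ.+-suc (suc p) q)) eq)) refl refl (track-right (suc p) q) refl
digitStep a (digit false zero    q       eq) = stuck refl refl eq
digitStep a (digit false (suc p) zero    eq) =
  moves (digit false p 1 (trans (ℕ.+-suc p 0) eq)) refl refl (track-left p 0) refl
digitStep a (digit false (suc p) (suc q) eq) =
  moves (digit false p (suc (suc q)) (trans (ℕ.+-suc p (suc q)) eq)) refl refl (track-left p (suc q)) refl

-- A number in base `n + 2`, least significant digit first, whose digits count the moves left in the
-- current directions. A tick subtracts 1: a head at its end has digit 0, and turning around makes
-- it `n + 1`, which is the borrow.
countdown : ∀ {n k} → Vec (Digit n) k → ℕ
countdown         []       = 0
countdown {n} (d ∷ ds) = remaining d + suc (suc n) * countdown ds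

headings : ∀ {n k} → Vec (Digit n) k → Vec Bool k
headings = Vec.map rightward

digitTapes : ∀ {a n k} → Vec (Digit n) k → Vec (Tape a) k
digitTapes = Vec.map digitTape

data Ticks (a : ℕ) {n k} (ds : Vec (Digit n) k) : Set where
  stop : tick {a} (headings ds) (Vec.map scan (digitTapes ds)) ≡ nothing → countdown ds ≡ 0 → Ticks a ds
  go   : ∀ (ds′ : Vec (Digit n) k) ws → tick {a} (headings ds) (Vec.map scan (digitTapes ds)) ≡ just (headings ds′ , ws) →
         Vec.zipWith writeMove ws (digitTapes ds) ≡ digitTapes ds′ →
         countdown ds ≡ suc (countdown ds′) → Ticks a ds

ticks : ∀ a {n k} (ds : Vec (Digit n) k) → Ticks a ds
ticks a [] = stop refl refl
ticks a {n} (d ∷ ds) with digitStep a d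
... | moves d′ ex h≡ t≡ r≡ =
  go (d′ ∷ ds) ((scan (digitTape d) , heading (rightward d)) ∷ keep (Vec.map scan (digitTapes ds)))
     (trans (tick-moves (rightward d) (headings ds) (scan (digitTape d)) _ ex)
            (cong (λ h → just (h ∷ headings ds , (scan (digitTape d) , heading (rightward d)) ∷ _)) (sym h≡)))
     (cong₂ _∷_ t≡ (keep-writes (digitTapes ds)))
     (cong (_+ suc (suc n) * countdown ds) r≡)
... | stuck ex r≡ r′≡ with ticks a ds
...   | stop tick≡ c≡ =
  stop (trans (tick-turns (rightward d) (headings ds) _ _ ex) (cong (Maybe.map _) tick≡)) countdown≡
  where
  countdown≡ : countdown (d ∷ ds) ≡ 0
  -- The product `suc (suc n) * 0` computes to `n * 0`.
  countdown≡ = trans (cong₂ (λ r c → r + suc (suc n) * c) r≡ c≡) (ℕ.*-zeroʳ n)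
...   | go ds′ ws tick≡ t≡ c≡ =
  go (turn d ∷ ds′) ((scan (digitTape d) , stay) ∷ ws)
     (trans (tick-turns (rightward d) (headings ds) _ _ ex) (cong (Maybe.map _) tick≡))
     (cong (_ ∷_) t≡) countdown≡
  where
  countdown≡ : countdown (d ∷ ds) ≡ suc (countdown (turn d ∷ ds′))
  countdown≡ = begin
    remaining d + suc (suc n) * countdown ds                 ≡⟨ cong₂ (λ r c → r + suc (suc n) * c) r≡ c≡ ⟩
    suc (suc n) * suc (countdown ds′)                        ≡⟨ ℕ.*-suc (suc (suc n)) (countdown ds′) ⟩
    suc (suc n + suc (suc n) * countdown ds′)                ≡⟨ cong (λ r → suc (r + suc (suc n) * countdown ds′)) r′≡ ⟨
    suc (remaining (turn d) + suc (suc n) * countdown ds′)   ∎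
    where open ≡-Reasoning

-- The position in which the first pass leaves the clocks: all heads on the right mark, about to go
-- left.
fullDigits : ∀ n k → Vec (Digit n) k
fullDigits n k = Vec.replicate k (digit false (suc n) 0 (ℕ.+-identityʳ (suc n)))

countdown-full : ∀ n k → suc (countdown (fullDigits n k)) ≡ (n + 2) ^ k
countdown-full n zero    = refl
countdown-full n (suc k) = begin
  suc (suc n + suc (suc n) * countdown (fullDigits n k)) ≡⟨ ℕ.*-suc (suc (suc n)) (countdown (fullDigits n k)) ⟨
  suc (suc n) * suc (countdown (fullDigits n k))         ≡⟨ cong₂ _*_ (ℕ.+-comm 2 n) (countdown-full n k) ⟩
  (n + 2) * (n + 2) ^ k                                  ∎
  where open ≡-Reasoning

-- Polynomial bounds

^-distribʳ-* : ∀ k m n → (m * n) ^ k ≡ m ^ k * n ^ k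
^-distribʳ-* zero    m n = refl
^-distribʳ-* (suc k) m n = trans (cong (m * n *_) (^-distribʳ-* k m n)) (ℕ.[m*n]*[o*p]≡[m*o]*[n*p] m n (m ^ k) (n ^ k))

n<2^n : ∀ n → n < 2 ^ n
n<2^n zero    = s≤s z≤n
n<2^n (suc n) = begin
  suc (suc n)   ≤⟨ s≤s (ℕ.m≤n+m (suc n) n) ⟩
  suc n + suc n ≡⟨ cong (λ m → suc n + m) (ℕ.+-identityʳ (suc n)) ⟨
  2 * suc n     ≤⟨ ℕ.*-monoʳ-≤ 2 (n<2^n n) ⟩
  2 ^ suc n     ∎
  where open ℕ.≤-Reasoning

-- As the base is at least 2, `c` of its factors outweigh the coefficient, and one more absorbs the
-- sum of two terms.
polynomial<power : ∀ c d n → c * n ^ d + c < (n + 2) ^ suc (d + c)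
polynomial<power c d n = begin-strict
  c * n ^ d + c                     ≤⟨ ℕ.+-mono-≤ (ℕ.*-monoʳ-≤ c (ℕ.^-monoˡ-≤ d (ℕ.m≤m+n n 2))) (ℕ.m≤m*n c Y) ⟩
  c * Y + c * Y                     ≡⟨ solve 2 (λ c y → c :* y :+ c :* y := con 2 :* (y :* c)) refl c Y ⟩
  2 * (Y * c)                       <⟨ ℕ.*-monoʳ-< 2 (ℕ.*-monoʳ-< Y (n<2^n c)) ⟩
  2 * (Y * 2 ^ c)                   ≤⟨ ℕ.*-mono-≤ (ℕ.m≤n+m 2 n) (ℕ.*-monoʳ-≤ Y (ℕ.^-monoˡ-≤ c (ℕ.m≤n+m 2 n))) ⟩
  (n + 2) * (Y * (n + 2) ^ c)       ≡⟨ cong ((n + 2) *_) (ℕ.^-distribˡ-+-* (n + 2) d c) ⟨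
  (n + 2) ^ suc (d + c)             ∎
  where
  open ℕ.≤-Reasoning
  open +-*-Solver
  Y = (n + 2) ^ d
  instance
    n+2≢0 : ℕ.NonZero (n + 2)
    n+2≢0 = ℕ.>-nonZero (ℕ.≤-trans (s≤s z≤n) (ℕ.m≤n+m 2 n))
    Y≢0 : ℕ.NonZero Y
    Y≢0 = ℕ.m^n≢0 (n + 2) d

-- For positive `n`, `n + 2` is at most `3 * n`; the constant term covers `n = 0`.
power≤polynomial : ∀ k n → (n + 2) ^ k ≤ 3 ^ k * n ^ k + 3 ^ k
power≤polynomial k zero    = ℕ.≤-trans (ℕ.^-monoˡ-≤ k (s≤s (s≤s z≤n))) (ℕ.m≤n+m (3 ^ k) (3 ^ k * 0 ^ k))
power≤polynomial k (suc n) = begin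
  (suc n + 2) ^ k               ≤⟨ ℕ.^-monoˡ-≤ k 1+n+2≤ ⟩
  (3 * suc n) ^ k               ≡⟨ ^-distribʳ-* k 3 (suc n) ⟩
  3 ^ k * suc n ^ k             ≤⟨ ℕ.m≤m+n _ _ ⟩
  3 ^ k * suc n ^ k + 3 ^ k     ∎
  where
  open ℕ.≤-Reasoning
  1+n+2≤ : suc n + 2 ≤ 3 * suc n
  1+n+2≤ = begin
    suc n + 2              ≤⟨ ℕ.+-monoʳ-≤ (suc n) (ℕ.*-monoʳ-≤ 2 (s≤s (z≤n {n}))) ⟩
    suc n + 2 * suc n      ∎

-- Auxiliary facts on vectors

take-++ : ∀ {A : Set} {m n} (xs : Vec A m) (ys : Vec A n) → Vec.take m (xs Vec.++ ys) ≡ xs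
take-++ []       ys = refl
take-++ (x ∷ xs) ys = cong (x ∷_) (take-++ xs ys)

drop-++ : ∀ {A : Set} {m n} (xs : Vec A m) (ys : Vec A n) → Vec.drop m (xs Vec.++ ys) ≡ ys
drop-++ []       ys = refl
drop-++ (x ∷ xs) ys = drop-++ xs ys

replicate-++ : ∀ {A : Set} m n (x : A) → Vec.replicate (m + n) x ≡ Vec.replicate m x Vec.++ Vec.replicate n x
replicate-++ zero    n x = refl
replicate-++ (suc m) n x = cong (x ∷_) (replicate-++ m n x)

Vec-Bool↔Fin : ∀ n → Vec Bool n ↔ Fin (2 ^ n)
Vec-Bool↔Fin zero    = mk↔ₛ′ (λ _ → Fin.zero) (λ _ → []) (λ { Fin.zero → refl ; (Fin.suc ()) }) (λ { [] → refl })
Vec-Bool↔Fin (suc n) = ↔-sym Fin.*↔× ↔-∘ ((↔-sym Fin.2↔Bool ×-↔ Vec-Bool↔Fin n) ↔-∘ uncons↔)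
  where
  uncons↔ : Vec Bool (suc n) ↔ (Bool × Vec Bool n)
  uncons↔ = mk↔ₛ′ (λ { (b ∷ bs) → b , bs }) (λ { (b , bs) → b ∷ bs }) (λ { (b , bs) → refl }) (λ { (b ∷ bs) → refl })

-- The doubling machine

translate : Bool → OutSymbol → OutSymbol
translate false s = s
translate true  s = digit (asBit s)

module Doubling (M : Machine) (k : ℕ) where
  open Machine M using (State; size; finite; workTapes; auxCount; start; accepting; δ; distinct)
  private
    module C = Computation M

  -- The middle summand stores the directions of the clock heads. The Boolean in the last one is the
  -- mode, `true` standing for the padded one.
  State′ : Set
  State′ = Fin 3 ⊎ Vec Bool (suc k) ⊎ (Bool × State)

  pattern launching      = inj₁ 0F
  pattern measuring      = inj₁ 1F
  pattern rewinding      = inj₁ 2F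
  pattern ticking ds     = inj₂ (inj₁ ds)
  pattern simulating m q = inj₂ (inj₂ (m , q))

  finite′ : State′ ↔ Fin (3 + (2 ^ suc k + 2 * size))
  finite′ = ↔-sym Fin.+↔⊎ ↔-∘ (↔-id (Fin 3) ⊎-↔
              (↔-sym Fin.+↔⊎ ↔-∘ (Vec-Bool↔Fin (suc k) ⊎-↔
                (↔-sym Fin.*↔× ↔-∘ (↔-sym Fin.2↔Bool ×-↔ finite)))))

  Act′ : Set
  Act′ = Action State′ (suc workTapes + suc k) auxCount

  clockWrites : Symbol auxCount × Move → Vec (Symbol auxCount × Move) (suc k)
  clockWrites = Vec.replicate (suc k)

  -- Distinct emissions may have the same translation; recording the emission on
  -- the clock tapes, which are no longer needed, keeps the actions distinct.
  record-emission : Maybe OutSymbol → Symbol auxCount × Move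
  record-emission nothing          = blank , stay
  record-emission (just minus)     = blank , left
  record-emission (just (digit b)) = bit b , stay

  record-emission-injective : ∀ {e e′} → record-emission e ≡ record-emission e′ → e ≡ e′
  record-emission-injective {nothing}        {nothing}        _    = refl
  record-emission-injective {nothing}        {just minus}     ()
  record-emission-injective {nothing}        {just (digit _)} ()
  record-emission-injective {just minus}     {just minus}     _    = refl
  record-emission-injective {just (digit b)} {just (digit .b)} refl = refl

  lift : Bool → C.Act → Act′
  lift m (action q ws e) =
    action (simulating m q) (ws Vec.++ clockWrites (record-emission e)) (Maybe.map (translate m) e)

  lift-injective : ∀ {m α β} → lift m α ≡ lift m β → α ≡ β
  lift-injective {m} {action q ws e} {action q′ ws′ e′} eq
    with refl ← cong next eq
    with refl , vs≡ ← Vec.++-injective ws ws′ (cong writes eq)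
    -- There is at least one clock tape, and what is written on the first one reveals the emission.
    with refl ← record-emission-injective {e} {e′} (cong Vec.head vs≡)
    = refl

  plainLaunch paddedLaunch : Vec (Symbol auxCount) (suc workTapes) → Vec (Symbol auxCount) (suc k) → Act′
  plainLaunch  ss us = action (simulating false start) (keep ss Vec.++ keep us) nothing
  paddedLaunch ss us = action measuring (keep ss Vec.++ clockWrites (bit false , right)) (just (digit true))

  -- Launching has put the left mark on every clock. Each input bit adds a blank cell and the end of
  -- the input the right mark, `n + 2` cells in all; then the input head walks back.
  measure rewind : Vec (Symbol auxCount) (suc workTapes) → Vec (Symbol auxCount) (suc k) → Act′
  measure (bit b ∷ ss) us =
    action measuring ((bit b , right) ∷ keep ss Vec.++ clockWrites (blank , right)) (just (digit false))
  measure (s ∷ ss) us =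
    action rewinding ((s , left) ∷ keep ss Vec.++ clockWrites (bit true , stay)) (just (digit false))
  rewind (bit b ∷ ss) us =
    action rewinding ((bit b , left) ∷ keep ss Vec.++ keep us) (just (digit false))
  rewind (s ∷ ss) us =
    -- All clock heads stand on right marks, so they start leftwards.
    action (ticking (Vec.replicate (suc k) false)) ((s , right) ∷ keep ss Vec.++ keep us) (just (digit false))

  tickAction : Vec (Symbol auxCount) (suc workTapes) → Vec (Symbol auxCount) (suc k) →
               Maybe (Vec Bool (suc k) × Vec (Symbol auxCount × Move) (suc k)) → Act′
  tickAction ss us (just (ds , ws)) = action (ticking ds) (keep ss Vec.++ ws) (just (digit false))
  tickAction ss us nothing          = action (simulating true start) (keep ss Vec.++ keep us) nothing

  transitions : State′ → Vec (Symbol auxCount) (suc workTapes) → Vec (Symbol auxCount) (suc k) → List Act′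
  transitions launching        ss us = plainLaunch ss us ∷ paddedLaunch ss us ∷ []
  transitions measuring        ss us = measure ss us ∷ []
  transitions rewinding        ss us = rewind ss us ∷ []
  transitions (ticking ds)     ss us = tickAction ss us (tick ds us) ∷ []
  transitions (simulating m q) ss us = List.map (lift m) (δ q ss)

  transitions-distinct : ∀ q ss us → Unique (transitions q ss us)
  transitions-distinct launching        ss us = ((λ ()) ∷ []) ∷ [] ∷ []
  transitions-distinct measuring        ss us = [] ∷ []
  transitions-distinct rewinding        ss us = [] ∷ []
  transitions-distinct (ticking ds)     ss us = [] ∷ []
  transitions-distinct (simulating m q) ss us = Unique.map⁺ lift-injective (distinct q ss)

  accepting′ : State′ → Bool
  accepting′ (simulating _ q) = accepting q
  accepting′ _                = false

  doubledMachine : Machine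
  doubledMachine = record
    { State     = State′
    ; size      = 3 + (2 ^ suc k + 2 * size)
    ; finite    = finite′
    ; workTapes = workTapes + suc k
    ; auxCount  = auxCount
    ; start     = launching
    ; accepting = accepting′
    ; δ         = λ q ss → transitions q (Vec.take (suc workTapes) ss) (Vec.drop (suc workTapes) ss)
    ; distinct  = λ q ss → transitions-distinct q (Vec.take (suc workTapes) ss) (Vec.drop (suc workTapes) ss)
    }

  private
    module D = Computation doubledMachine
    module PC = Paths M
    module PD = Paths doubledMachine

  Tapes : ℕ → Set
  Tapes = Vec (Tape auxCount)

  enabled-++ : ∀ q (ts : Tapes (suc workTapes)) (us : Tapes (suc k)) o →
               D.enabled (D.config q (ts Vec.++ us) o) ≡ transitions q (Vec.map scan ts) (Vec.map scan us)
  enabled-++ q ts us o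
    rewrite Vec.map-++ scan ts us
          | take-++ (Vec.map scan ts) (Vec.map scan us)
          | drop-++ (Vec.map scan ts) (Vec.map scan us)
    = refl

  apply-++ : ∀ q ws vs e q′ (ts ts′ : Tapes (suc workTapes)) (us us′ : Tapes (suc k)) o o′ →
             Vec.zipWith writeMove ws ts ≡ ts′ → Vec.zipWith writeMove vs us ≡ us′ → o ++ D.emitted e ≡ o′ →
             D.apply (action q (ws Vec.++ vs) e) (D.config q′ (ts Vec.++ us) o) ≡ D.config q (ts′ Vec.++ us′) o′
  apply-++ q ws vs e q′ ts _ us _ o _ refl refl refl =
    cong (λ τ → D.config q τ (o ++ D.emitted e)) (Vec.zipWith-++ writeMove ws vs ts us)

  -- Simulation

  -- The clock contents are arbitrary, as emissions get recorded there; the other tapes agree up to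
  -- trailing blanks. `prefix` is the output printed before the simulation started.
  record Simulates (m : Bool) (prefix : List OutSymbol) (c : C.Config) (c′ : D.Config) : Set where
    constructor simulates
    field
      mirrored : Tapes (suc workTapes)
      clock    : Tapes (suc k)
      output′  : List OutSymbol
      config≡  : c′ ≡ D.config (simulating m (C.state c)) (mirrored Vec.++ clock) output′
      similar  : Pointwise _≼_ (C.tapes c) mirrored
      output≡  : output′ ≡ prefix ++ List.map (translate m) (C.output c)

  module _ {m : Bool} {prefix : List OutSymbol} where

    simulates-output : ∀ {c c′} → Simulates m prefix c c′ →
                       D.output c′ ≡ prefix ++ List.map (translate m) (C.output c)
    simulates-output (simulates _ _ _ refl _ output≡) = output≡

    simulates-accepting : ∀ {c c′} → Simulates m prefix c c′ →
                          accepting′ (D.state c′) ≡ accepting (C.state c)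
    simulates-accepting (simulates _ _ _ refl _ _) = refl

    simulates-enabled : ∀ {c c′} → Simulates m prefix c c′ → D.enabled c′ ≡ List.map (lift m) (C.enabled c)
    simulates-enabled {c} (simulates ts us o refl ts≼ _) =
      trans (enabled-++ (simulating m (C.state c)) ts us o)
            (cong (λ ss → List.map (lift m) (δ (C.state c) ss)) (sym (≼-scans ts≼)))

    simulates-apply : ∀ {c c′} α → Simulates m prefix c c′ →
                      Simulates m prefix (C.apply α c) (D.apply (lift m α) c′)
    simulates-apply {c} (action q ws e) (simulates ts us o refl ts≼ refl) =
      simulates _ _ _ (apply-++ _ ws _ _ (simulating m (C.state c)) ts _ us _ o _ refl refl refl)
                (≼-writeMoves ws ts≼) (output-step e)
      where
      output-step : ∀ e → (prefix ++ List.map (translate m) (C.output c)) ++ D.emitted (Maybe.map (translate m) e) ≡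
                    prefix ++ List.map (translate m) (C.output c ++ C.emitted e)
      output-step e = begin
        (prefix ++ List.map (translate m) (C.output c)) ++ D.emitted (Maybe.map (translate m) e)
          ≡⟨ List.++-assoc prefix _ _ ⟩
        prefix ++ List.map (translate m) (C.output c) ++ D.emitted (Maybe.map (translate m) e)
          ≡⟨ cong (λ s → prefix ++ List.map (translate m) (C.output c) ++ s) (emitted-map e) ⟩
        prefix ++ List.map (translate m) (C.output c) ++ List.map (translate m) (C.emitted e)
          ≡⟨ cong (prefix ++_) (List.map-++ (translate m) (C.output c) (C.emitted e)) ⟨
        prefix ++ List.map (translate m) (C.output c ++ C.emitted e) ∎
        where
        open ≡-Reasoning
        emitted-map : ∀ e → D.emitted (Maybe.map (translate m) e) ≡ List.map (translate m) (C.emitted e)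
        emitted-map nothing  = refl
        emitted-map (just _) = refl

    simulate : ∀ {c c′} → Simulates m prefix c c′ → C.PathFrom c → D.PathFrom c′
    simulate s (C.halt h)     = D.halt (trans (simulates-enabled s) (cong (List.map (lift m)) h))
    simulate s (C.step α α∈ p) =
      D.step (lift m α) (subst (lift m α ∈_) (sym (simulates-enabled s)) (∈.∈-map⁺ (lift m) α∈))
             (simulate (simulates-apply α s) p)

    simulate-final : ∀ {c c′} (s : Simulates m prefix c c′) (p : C.PathFrom c) →
                     Simulates m prefix (C.final p) (D.final (simulate s p))
    simulate-final s (C.halt _)     = s
    simulate-final s (C.step α _ p) = simulate-final (simulates-apply α s) p

    simulate-trace : ∀ {c c′} (s : Simulates m prefix c c′) (p : C.PathFrom c) →
                     PD.trace (simulate s p) ≡ List.map (lift m) (PC.trace p)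
    simulate-trace s (C.halt _)     = refl
    simulate-trace s (C.step α _ p) = cong (lift m α ∷_) (simulate-trace (simulates-apply α s) p)

    simulate-injective : ∀ {c c′} (s : Simulates m prefix c c′) (p q : C.PathFrom c) →
                         simulate s p ≡ simulate s q → p ≡ q
    simulate-injective s p q eq =
      PC.trace-injective p q (List.map-injective lift-injective
        (trans (sym (simulate-trace s p)) (trans (cong PD.trace eq) (simulate-trace s q))))

    simulate-surjective : ∀ {c c′} (s : Simulates m prefix c c′) (p : D.PathFrom c′) → ∃[ q ] simulate s q ≡ p
    simulate-surjective {c} s (D.halt h) = C.halt halted , PD.trace-injective _ _ refl
      where
      halted : C.enabled c ≡ []
      halted with C.enabled c | simulates-enabled s
      ... | []    | _  = refl
      ... | _ ∷ _ | eq = contradiction (trans (sym h) eq) λ ()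
    simulate-surjective s (D.step β β∈ p)
      with α , α∈ , refl ← ∈.∈-map⁻ (lift m) (subst (β ∈_) (simulates-enabled s) β∈)
      with q , refl ← simulate-surjective (simulates-apply α s) p
      = C.step α α∈ q , PD.trace-injective (simulate s (C.step α α∈ q)) (D.step (lift m α) β∈ _) refl

    -- Carries time bounds over from `M`: the simulation takes one step for each step of `M`.
    simulate-reflects : ∀ {c c′ t κ} → Simulates m prefix c c′ → D.Reaches c′ t κ → ∃[ κ′ ] C.Reaches c t κ′
    simulate-reflects s D.none = _ , C.none
    simulate-reflects s (D.step β β∈ r)
      with α , α∈ , refl ← ∈.∈-map⁻ (lift m) (subst (β ∈_) (simulates-enabled s) β∈)
      with κ′ , r′ ← simulate-reflects (simulates-apply α s) r
      = κ′ , C.step α α∈ r′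

  -- Launching

  zeros : ℕ → List OutSymbol
  zeros j = List.map digit (true ∷ replicate j false)

  zeros-step : ∀ j → zeros j ++ digit false ∷ [] ≡ zeros (suc j)
  zeros-step j = cong (digit true ∷_) (trans (sym (List.map-++ digit (replicate j false) (false ∷ [])))
                                             (cong (List.map digit) (replicate-∷ʳ j)))
    where
    replicate-∷ʳ : ∀ j → replicate j false ++ false ∷ [] ≡ false ∷ replicate j false
    replicate-∷ʳ zero    = refl
    replicate-∷ʳ (suc j) = cong (false ∷_) (replicate-∷ʳ j)

  forced-step : ∀ {n q ts ts′ us us′ o o′ c} q′ ws vs e →
                transitions q (Vec.map scan ts) (Vec.map scan us) ≡ action q′ (ws Vec.++ vs) e ∷ [] →
                Vec.zipWith writeMove ws ts ≡ ts′ → Vec.zipWith writeMove vs us ≡ us′ → o ++ D.emitted e ≡ o′ →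
                PD.Forced n (D.config q′ (ts′ Vec.++ us′) o′) c →
                PD.Forced (suc n) (D.config q (ts Vec.++ us) o) c
  forced-step {q = q} {ts} {ts′} {us} {us′} {o} {o′} q′ ws vs e t≡ ts≡ us≡ o≡ =
    PD.step (action q′ (ws Vec.++ vs) e) (trans (enabled-++ q ts us o) t≡)
            (apply-++ q′ ws vs e q ts ts′ us us′ o o′ ts≡ us≡ o≡)

  -- The end of the word appears as a blank under the head, which gives the sweeps one invariant for
  -- empty and nonempty remainders.
  forward backward : List Bool → List (Symbol auxCount) → Tape auxCount
  forward  []       ls = tape ls blank []
  forward  (b ∷ bs) ls = tape ls (bit b) (List.map bit bs)
  backward []       rs = tape [] blank rs
  backward (b ∷ bs) rs = tape (List.map bit bs) (bit b) rs

  forward-input : ∀ x → inputTape x ≡ forward x []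
  forward-input []      = refl
  forward-input (_ ∷ _) = refl

  forward-move : ∀ b bs ls → writeMove (bit b , right) (forward (b ∷ bs) ls) ≡ forward bs (bit b ∷ ls)
  forward-move b []       ls = refl
  forward-move b (_ ∷ bs) ls = refl

  backward-move : ∀ s bs rs → move left (tape (List.map bit bs) s rs) ≡ backward bs (s ∷ rs)
  backward-move s []       rs = refl
  backward-move s (_ ∷ bs) rs = refl

  -- A clock track under construction: left mark, `p` blanks, and the head on the next cell.
  unfinished : ℕ → Tape auxCount
  unfinished p = tape (side false (suc p)) blank []

  module _ (ts : Tapes workTapes) where

    measuring-config : Tape auxCount → ℕ → ℕ → D.Config
    measuring-config t p j = D.config measuring ((t ∷ ts) Vec.++ Vec.replicate (suc k) (unfinished p)) (zeros j)

    -- The bits passed pile up in reverse to the left of the head, and each one lengthens the clock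
    -- tracks and the padding by one.
    forced-measuring : ∀ bs as p j →
      PD.Forced (length bs) (measuring-config (forward bs (List.map bit as)) p j)
                (measuring-config (forward [] (List.map bit (bs List.ʳ++ as))) (length bs + p) (length bs + j))
    forced-measuring []       as p j = PD.done refl
    forced-measuring (b ∷ bs) as p j =
      forced-step measuring _ _ (just (digit false)) refl
        (cong₂ _∷_ (forward-move b bs _) (keep-writes ts))
        (Vec.zipWith-replicate writeMove _ _)
        (zeros-step j)
        (PD.forced-target
          (cong₂ (measuring-config (forward [] (List.map bit (bs List.ʳ++ b ∷ as))))
                 (ℕ.+-suc (length bs) p) (ℕ.+-suc (length bs) j))
          (forced-measuring bs (b ∷ as) (suc p) (suc j)))

    rewinding-config : Tape auxCount → Tapes (suc k) → ℕ → D.Config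
    rewinding-config t us j = D.config rewinding ((t ∷ ts) Vec.++ us) (zeros j)

    forced-rewinding : ∀ bs rs us j →
      PD.Forced (length bs) (rewinding-config (backward bs rs) us j)
                (rewinding-config (backward [] (List.map bit bs List.ʳ++ rs)) us (length bs + j))
    forced-rewinding []       rs us j = PD.done refl
    forced-rewinding (b ∷ bs) rs us j =
      forced-step rewinding _ _ (just (digit false)) refl
        (cong₂ _∷_ (backward-move (bit b) bs rs) (keep-writes ts))
        (keep-writes us)
        (zeros-step j)
        (PD.forced-target
          (cong (rewinding-config (backward [] (List.map bit bs List.ʳ++ bit b ∷ rs)) us) (ℕ.+-suc (length bs) j))
          (forced-rewinding bs (bit b ∷ rs) us (suc j)))

  -- Each of `v` ticks prints a zero; the last step, on exhaustion, starts the simulation and prints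
  -- nothing.
  forced-ticking : ∀ {n} v (ts : Tapes (suc workTapes)) (ds : Vec (Digit n) (suc k)) j → countdown ds ≡ v →
    ∃[ us ] PD.Forced (suc v) (D.config (ticking (headings ds)) (ts Vec.++ digitTapes ds) (zeros j))
                      (D.config (simulating true start) (ts Vec.++ us) (zeros (v + j)))
  forced-ticking v ts ds j v≡ with ticks auxCount ds
  forced-ticking zero ts ds j v≡ | stop t≡ _ =
    digitTapes ds ,
    forced-step (simulating true start) _ _ nothing
      (cong (λ r → tickAction (Vec.map scan ts) (Vec.map scan (digitTapes ds)) r ∷ []) t≡)
      (keep-writes ts) (keep-writes (digitTapes ds)) (List.++-identityʳ (zeros j)) (PD.done refl)
  forced-ticking (suc v) ts ds j v≡ | stop _ c≡ = contradiction (trans (sym v≡) c≡) λ ()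
  forced-ticking zero ts ds j v≡ | go _ _ _ _ c≡ = contradiction (trans (sym v≡) c≡) λ ()
  forced-ticking (suc v) ts ds j v≡ | go ds′ ws t≡ us≡ c≡
    with us , f ← forced-ticking v ts ds′ (suc j) (ℕ.suc-injective (trans (sym c≡) v≡))
    = us ,
      forced-step (ticking (headings ds′)) _ _ (just (digit false))
        (cong (λ r → tickAction (Vec.map scan ts) (Vec.map scan (digitTapes ds)) r ∷ []) t≡)
        (keep-writes ts) us≡ (zeros-step j)
        (PD.forced-target
          (cong (λ j′ → D.config (simulating true start) (ts Vec.++ us) (zeros j′)) (ℕ.+-suc v j)) f)

  -- Indexed by the input alone, so that all paths of the second mode share the same `padding`.
  record Launch (x : Word) : Set where
    field
      padding  : ℕ
      duration : ℕ
      input    : Tape auxCount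
      clock    : Tapes (suc k)
      forced   : PD.Forced duration
                   (measuring-config (Vec.replicate workTapes blankTape) (inputTape x) 0 0)
                   (D.config (simulating true start) ((input ∷ Vec.replicate workTapes blankTape) Vec.++ clock)
                             (zeros padding))
      similar   : inputTape x ≼ input
      padding≥  : (length x + 2) ^ suc k ≤ suc padding
      duration≤ : duration ≤ length x + (1 + (length x + (1 + (length x + 2) ^ suc k)))

  launch : ∀ x → Launch x
  launch x = launched
    where
    n = length x
    ts : Tapes workTapes
    ts = Vec.replicate workTapes blankTape
    y = x List.ʳ++ []
    ds = fullDigits n (suc k)
    v = countdown ds
    -- The zeros printed before ticking: one for each bit on the way out, one at the end, one for
    -- each bit on the way back, and one on turning to the clock.
    j = suc (length y + suc (n + 0))
    rewound : List (Symbol auxCount)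
    rewound = List.map bit y List.ʳ++ blank ∷ []

    y-length : length y ≡ n
    y-length = trans (List.length-ʳ++ x) (ℕ.+-identityʳ n)

    rewound≡ : rewound ≡ List.map bit x ++ blank ∷ []
    rewound≡ = trans (cong (List._ʳ++ blank ∷ []) (List.map-ʳ++ bit x)) (List.ʳ++-ʳ++ (List.map bit x))

    -- The sweeps leave a blank to the left of the head and, for nonempty input, one behind the last
    -- bit.
    similar′ : ∀ w → inputTape w ≼ move right (backward [] (List.map bit w ++ blank ∷ []))
    similar′ []      = tape (pad []) []
    similar′ (_ ∷ w) = tape (pad []) ≲-blank

    ticking-forced = forced-ticking v (writeMove (blank , right) (backward [] rewound) ∷ ts) ds j refl

    forced′ : PD.Forced (n + (1 + (length y + (1 + suc v))))
                (measuring-config ts (inputTape x) 0 0)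
                (D.config (simulating true start)
                  ((writeMove (blank , right) (backward [] rewound) ∷ ts) Vec.++ proj₁ ticking-forced) (zeros (v + j)))
    forced′ =
      PD.forced-++
        -- A forced run of length 0 rewrites the initial configuration into the form of the
        -- invariant.
        (PD.forced-++ (PD.done (cong (λ t → measuring-config ts t 0 0) (forward-input x))) (forced-measuring ts x [] 0 0))
        (forced-step rewinding _ _ (just (digit false)) refl
          (cong₂ _∷_ (backward-move blank y []) (keep-writes ts))
          (trans (Vec.zipWith-replicate writeMove _ _) clocks-marked)
          (zeros-step (n + 0))
          (PD.forced-++
            (forced-rewinding ts y (blank ∷ []) (digitTapes ds) (suc (n + 0)))
            (forced-step (ticking (headings ds)) ws vs (just (digit false))
              (cong (λ h → action (ticking h) (ws Vec.++ vs) (just (digit false)) ∷ []) (sym (Vec.map-replicate Digit.rightward _ (suc k))))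
              (cong (writeMove (blank , right) (backward [] rewound) ∷_) (keep-writes ts))
              (keep-writes (digitTapes ds))
              (zeros-step (length y + suc (n + 0)))
              (proj₂ ticking-forced))))
      where
      ws = (blank , right) ∷ keep (Vec.map scan ts)
      vs = keep (Vec.map scan (digitTapes ds))
      clocks-marked : Vec.replicate (suc k) (writeMove (bit true , stay) (unfinished (n + 0))) ≡ digitTapes ds
      clocks-marked = trans (cong (λ p → Vec.replicate (suc k) (writeMove (bit true , stay) (unfinished p))) (ℕ.+-identityʳ n))
                            (sym (Vec.map-replicate digitTape _ (suc k)))

    launched : Launch x
    launched = record
      { padding   = v + j
      ; duration  = n + (1 + (length y + (1 + suc v)))
      ; input     = writeMove (blank , right) (backward [] rewound)
      ; clock     = proj₁ ticking-forced
      ; forced    = forced′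
      ; similar   = subst (λ rs → inputTape x ≼ move right (backward [] rs)) (sym rewound≡) (similar′ x)
      ; padding≥  = subst (_≤ suc (v + j)) (countdown-full n (suc k)) (s≤s (ℕ.m≤m+n v j))
      ; duration≤ = ℕ.≤-reflexive (cong₂ (λ l c → n + (1 + (l + (1 + c)))) y-length (countdown-full n (suc k)))
      }

  -- The two families of paths

  module _ (x : Word) where
    open Launch (launch x)

    private
      inputs : Tapes (suc workTapes)
      inputs = inputTape x ∷ Vec.replicate workTapes blankTape
      clocks : Tapes (suc k)
      clocks = Vec.replicate (suc k) blankTape
      toPlain toPadded : Act′
      toPlain   = plainLaunch (Vec.map scan inputs) (Vec.map scan clocks)
      toPadded = paddedLaunch (Vec.map scan inputs) (Vec.map scan clocks)

    initial≡ : D.initial x ≡ D.config launching (inputs Vec.++ clocks) []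
    initial≡ = cong (λ ts → D.config launching (inputTape x ∷ ts) []) (replicate-++ workTapes (suc k) blankTape)

    initial-enabled : D.enabled (D.initial x) ≡ toPlain ∷ toPadded ∷ []
    initial-enabled = trans (cong D.enabled initial≡) (enabled-++ launching inputs clocks [])

    simulates-plain : Simulates false [] (C.initial x) (D.apply toPlain (D.initial x))
    simulates-plain =
      simulates inputs clocks []
        (trans (cong (D.apply toPlain) initial≡)
               (apply-++ _ (keep (Vec.map scan inputs)) (keep (Vec.map scan clocks)) nothing launching inputs _ clocks _ [] _
                         (keep-writes inputs) (keep-writes clocks) refl))
        (Pointwise.refl ≼-refl) refl

    forced-padded : PD.Forced duration (D.apply toPadded (D.initial x))
                      (D.config (simulating true start) ((input ∷ Vec.replicate workTapes blankTape) Vec.++ clock)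
                                (zeros padding))
    forced-padded = PD.forced-++ (PD.done
      (trans (cong (D.apply toPadded) initial≡)
             (apply-++ _ (keep (Vec.map scan inputs)) _ (just (digit true)) launching inputs _ clocks _ [] _ (keep-writes inputs)
                       (Vec.zipWith-replicate {n = suc k} writeMove _ _) refl)))
      forced

    simulates-padded : Simulates true (zeros padding) (C.initial x)
                         (D.config (simulating true start) ((input ∷ Vec.replicate workTapes blankTape) Vec.++ clock)
                                   (zeros padding))
    simulates-padded =
      simulates _ clock _ refl (similar ∷ Pointwise.refl ≼-refl) (sym (List.++-identityʳ (zeros padding)))

    plainPath paddedPath : C.Path x → D.Path x
    plainPath  p = D.step toPlain (subst (toPlain ∈_) (sym initial-enabled) (here refl)) (simulate simulates-plain p)
    paddedPath p = D.step toPadded (subst (toPadded ∈_) (sym initial-enabled) (there (here refl)))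
                          (PD.extend forced-padded (simulate simulates-padded p))

    step-injective : ∀ {α c} {m m′ : α ∈ D.enabled c} {p q : D.PathFrom (D.apply α c)} →
                     D.step {c} α m p ≡ D.step α m′ q → p ≡ q
    step-injective refl = refl

    plainPath-injective : ∀ p q → plainPath p ≡ plainPath q → p ≡ q
    plainPath-injective p q eq = simulate-injective simulates-plain p q (step-injective eq)

    paddedPath-injective : ∀ p q → paddedPath p ≡ paddedPath q → p ≡ q
    paddedPath-injective p q eq =
      simulate-injective simulates-padded p q (PD.extend-injective forced-padded _ _ (step-injective eq))

    path-cases : ∀ r → (∃[ p ] plainPath p ≡ r) ⊎ (∃[ p ] paddedPath p ≡ r)
    path-cases (D.halt h) = contradiction (trans (sym initial-enabled) h) λ ()
    path-cases (D.step α m r) with subst (α ∈_) initial-enabled m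
    ... | here refl with p , refl ← simulate-surjective simulates-plain r =
      inj₁ (p , PD.trace-injective (plainPath p) (D.step α m r) refl)
    ... | there (here refl)
      with r′ , refl ← PD.extend-surjective forced-padded r
      with p , refl ← simulate-surjective simulates-padded r′ =
      inj₂ (p , PD.trace-injective (paddedPath p) (D.step α m r) refl)

    plainPath-output : ∀ p → D.output (D.final (plainPath p)) ≡ C.output (C.final p)
    plainPath-output p = trans (simulates-output (simulate-final simulates-plain p)) (List.map-id _)

    paddedPath-output : ∀ p → D.output (D.final (paddedPath p)) ≡
                              List.map digit (true ∷ padded padding (C.output (C.final p)))
    paddedPath-output p = begin
      D.output (D.final (paddedPath p))
        ≡⟨ cong D.output (PD.extend-final forced-padded (simulate simulates-padded p)) ⟩
      D.output (D.final (simulate simulates-padded p))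
        ≡⟨ simulates-output (simulate-final simulates-padded p) ⟩
      zeros padding ++ List.map (digit ∘ asBit) s
        ≡⟨ cong (zeros padding ++_) (List.map-∘ s) ⟩
      zeros padding ++ List.map digit (asBits s)
        ≡⟨ List.map-++ digit (true ∷ replicate padding false) (asBits s) ⟨
      List.map digit (true ∷ padded padding s) ∎
      where
      open ≡-Reasoning
      s = C.output (C.final p)

    plainPath-accepts : ∀ p → C.Accepts {x} p → D.Accepts {x} (plainPath p)
    plainPath-accepts p accepts = trans (simulates-accepting (simulate-final simulates-plain p)) accepts

    paddedPath-accepts : ∀ p → C.Accepts {x} p → D.Accepts {x} (paddedPath p)
    paddedPath-accepts p accepts =
      trans (cong (accepting′ ∘ D.state) (PD.extend-final forced-padded (simulate simulates-padded p)))
            (trans (simulates-accepting (simulate-final simulates-padded p)) accepts)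

    doubled-bound : ∀ {n} → (∀ {t κ} → C.Reaches (C.initial x) t κ → t ≤ n) →
                    ∀ {t κ} → D.Reaches (D.initial x) t κ → t ≤ suc (duration + n)
    doubled-bound bound D.none = z≤n
    doubled-bound {n} bound (D.step α m r) with subst (α ∈_) initial-enabled m
    ... | here refl = s≤s (ℕ.≤-trans (bound (proj₂ (simulate-reflects simulates-plain r))) (ℕ.m≤n+m n duration))
    ... | there (here refl) =
      s≤s (PD.forced-bound forced-padded (λ r′ → bound (proj₂ (simulate-reflects simulates-padded r′))) r)

  doubled-metric : C.Metric → D.Metric
  doubled-metric metric x r with path-cases x r
  ... | inj₁ (p , refl) with accepts , z , d ← metric x p =
    plainPath-accepts x p accepts , z , subst (_Denotes z) (sym (plainPath-output x p)) d
  -- With a leading 1, any bits behind it form a standard numeral.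
  ... | inj₂ (p , refl) with accepts , _ ← metric x p =
    paddedPath-accepts x p accepts , _ ,
    subst (_Denotes padded-value q s) (sym (paddedPath-output x p)) (positive (padded q s))
    where
    q = Launch.padding (launch x)
    s = C.output (C.final p)

  plainPath-key : ∀ x p → PD.key (plainPath x p) ≡ PC.key p
  plainPath-key x p = cong value (plainPath-output x p)

  paddedPath-key : ∀ x p → PD.key (paddedPath x p) ≡ padded-value (Launch.padding (launch x)) (C.output (C.final p))
  paddedPath-key x p =
    trans (cong value (paddedPath-output x p))
          (cong (λ bs → + binaryValue bs) (asBits-digits (true ∷ padded (Launch.padding (launch x)) (C.output (C.final p)))))

  -- An output of `M` has at most as many symbols as `M` makes steps, hence at most `padding`, and
  -- stays below `2 ^ padding`.
  plainPath<paddedPath : ∀ x {n} → (∀ {t κ} → C.Reaches (C.initial x) t κ → t ≤ n) → n < (length x + 2) ^ suc k →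
                         ∀ p q → PD.key (plainPath x p) ℤ.< PD.key (paddedPath x q)
  plainPath<paddedPath x {n} bound n<power p q = begin-strict
    PD.key (plainPath x p)  ≡⟨ plainPath-key x p ⟩
    PC.key p                <⟨ value-upper s ⟩
    + (2 ^ length s)        ≤⟨ ℤ.+≤+ (ℕ.^-monoʳ-≤ 2 (ℕ.≤-trans (PC.output-length (PC.run p))
                                        (ℕ.≤-trans (bound (PC.run p)) n≤padding))) ⟩
    + (2 ^ padding)         ≤⟨ padded-value-lower padding (C.output (C.final q)) ⟩
    padded-value padding (C.output (C.final q)) ≡⟨ paddedPath-key x q ⟨
    PD.key (paddedPath x q) ∎
    where
    open ℤ.≤-Reasoning
    open Launch (launch x) using (padding; padding≥)
    s = C.output (C.final p)
    n≤padding : n ≤ padding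
    n≤padding = ℕ.s≤s⁻¹ (ℕ.≤-trans n<power padding≥)

-- Choice of the clock, running time and conclusion

module _ (M : NPTM) (metric : NPTM.Metric M) where
  private
    module M = NPTM M

    coefficient degree : ℕ
    coefficient = proj₁ M.polynomialTime
    degree      = proj₁ (proj₂ M.polynomialTime)

    timeBound : ℕ → ℕ
    timeBound n = coefficient * n ^ degree + coefficient

    timeBound-correct : ∀ x {t κ} → M.Reaches (M.initial x) t κ → t ≤ timeBound (length x)
    timeBound-correct = proj₂ (proj₂ M.polynomialTime)

    exponent : ℕ
    exponent = suc (degree + coefficient)

  -- The machine has one clock more than this parameter, thus `exponent` clocks.
  open Doubling M.machine (degree + coefficient)

  private
    module PM = Paths M.machine
    module PN = Paths doubledMachine
    module N = Computation doubledMachine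

  doubled-polynomialTime : N.PolynomialTime
  -- The running time splits into four summands, each at most `(n + 2) ^ exponent`; the power of 3
  -- comes from `power≤polynomial`.
  doubled-polynomialTime = 4 * 3 ^ exponent , exponent , bounded
    where
    bounded : ∀ x {t κ} → N.Reaches (N.initial x) t κ →
              t ≤ 4 * 3 ^ exponent * length x ^ exponent + 4 * 3 ^ exponent
    bounded x {t} r = begin
      t                                   ≤⟨ doubled-bound x (timeBound-correct x) r ⟩
      suc (duration + T)                  ≤⟨ s≤s (ℕ.+-monoˡ-≤ T duration≤) ⟩
      suc (n + (1 + (n + (1 + P))) + T)   ≡⟨ solve 3 (λ n p t → con 1 :+ (n :+ (con 1 :+ (n :+ (con 1 :+ p))) :+ t) :=
                                                       (con 1 :+ n) :+ (con 1 :+ n) :+ p :+ (con 1 :+ t)) refl n P T ⟩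
      suc n + suc n + P + suc T           ≤⟨ ℕ.+-mono-≤ (ℕ.+-monoˡ-≤ P (ℕ.+-mono-≤ 1+n≤P 1+n≤P)) T<P ⟩
      P + P + P + P                       ≡⟨ solve 1 (λ p → p :+ p :+ p :+ p := con 4 :* p) refl P ⟩
      4 * P                               ≤⟨ ℕ.*-monoʳ-≤ 4 (power≤polynomial exponent n) ⟩
      4 * (Q * n ^ exponent + Q)          ≡⟨ solve 2 (λ q m → con 4 :* (q :* m :+ q) := con 4 :* q :* m :+ con 4 :* q)
                                                   refl Q (n ^ exponent) ⟩
      4 * Q * n ^ exponent + 4 * Q        ∎
      where
      open ℕ.≤-Reasoning
      open +-*-Solver
      open Launch (launch x)
      n = length x
      T = timeBound n
      P = (n + 2) ^ exponent
      Q = 3 ^ exponent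
      T<P : T < P
      T<P = polynomial<power coefficient degree n
      instance
        n+2≢0 : ℕ.NonZero (n + 2)
        n+2≢0 = ℕ.>-nonZero (ℕ.≤-trans (s≤s z≤n) (ℕ.m≤n+m 2 n))
      1+n≤P : suc n ≤ P
      1+n≤P = ℕ.≤-trans (ℕ.≤-trans (ℕ.n≤1+n (suc n)) (ℕ.≤-reflexive (ℕ.+-comm 2 n)))
                        (ℕ.m≤m*n (n + 2) ((n + 2) ^ (degree + coefficient)) ⦃ ℕ.m^n≢0 (n + 2) (degree + coefficient) ⦄)

  doubledNPTM : NPTM
  doubledNPTM = record { machine = doubledMachine ; polynomialTime = doubled-polynomialTime }

  twoCopies : ∀ x → TwoCopies M doubledNPTM x
  twoCopies x = record
    { low                = plainPath x
    ; high               = paddedPath x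
    ; low-injective      = plainPath-injective x
    ; high-injective     = paddedPath-injective x
    ; cover              = path-cases x
    ; low-key            = plainPath-key x
    ; high-key-cong      = high-key-cong
    ; high-key-injective = high-key-injective
    ; low<high           = plainPath<paddedPath x (timeBound-correct x) (polynomial<power coefficient degree (length x))
    }
    where
    open Launch (launch x) using (padding)

    high-key-cong : ∀ p q → PM.key p ≡ PM.key q → PN.key (paddedPath x p) ≡ PN.key (paddedPath x q)
    high-key-cong p q eq =
      trans (paddedPath-key x p)
        (trans (cong (padded-value padding)
                     (denotes-injective (outputs-key M metric x p) (outputs-key M metric x q) eq))
               (sym (paddedPath-key x q)))

    high-key-injective : ∀ p q → PN.key (paddedPath x p) ≡ PN.key (paddedPath x q) → PM.key p ≡ PM.key q
    high-key-injective p q eq =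
      cong value (padded-value-injective padding (outputs-key M metric x p) (outputs-key M metric x q)
        (trans (sym (paddedPath-key x p)) (trans eq (paddedPath-key x q))))

proposition6p5 : MaxP ⊆ (MedP ∩ MidP)
proposition6p5 (M , metric , max) =
  (N , metric′ , λ x → median M N metric metric′ x (twoCopies M metric x) (max x)) ,
  (N , metric′ , λ x → midpoint M N metric metric′ x (twoCopies M metric x) (max x))
  where
  N : NPTM
  N = doubledNPTM M metric
  metric′ : NPTM.Metric N
  metric′ = Doubling.doubled-metric (NPTM.machine M) _ metric
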